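{- Let $l \geq 1$ and $p_1, p_2, \ldots, p_m \geq 2$ be integers, let $n = l + \sum_{i=1}^m p_i$, and let $d \leq n-m$. Let $\Lambda = \Lambda(l;p_1,\ldots,p_m)$. If $M \subseteq S(\infty^{n-d-m}, p_1-1, p_2-1, \ldots, p_m-1)$ is a multicomplex with $\deg(M) \leq d$, then there is a $(d-1)$-dimensional shellable subcomplex $\Gamma$ of $\Lambda$ such that $h(\Gamma) = F(M)$.
   Context: $\Lambda(l;p_1,\ldots,p_m) = \Delta^{l-1} * \partial\Delta^{p_1-1} * \cdots * \partial\Delta^{p_m-1}$, where $\Delta^k$ is the $k$-simplex and $\partial \Delta^k$ its boundary complex; equivalently, it is the simplicial complex on a vertex set $V = V' \sqcup P_1 \sqcup \cdots \sqcup P_m$ with $|V'| = l$, $|P_i| = p_i$, whose faces are the subsets of $V$ containing no $P_i$. For $0 \le a_i \le \infty$, $S(a_1,\ldots,a_k)$ is the set of monomials $x_1^{c_1}\cdots x_k^{c_k}$ with $c_i \leq a_i$ for all $i$; $S(\infty^r, a_{r+1},\ldots,a_k)$ means $a_1=\cdots=a_r=\infty$. A multicomplex is a nonempty subset $M$ of such a set closed under divisibility. For finite $M$, $\deg(M)$ is the maximum total degree of its elements, and the $F$-vector is $F(M)=(F_0,F_1,\ldots)$ with $F_i$ the number of elements of $M$ of total degree $i$. The $h$-vector of a $(d-1)$-dimensional simplicial complex $\Gamma$ is $(h_0,\ldots,h_d)$ defined by $\sum_{i=0}^d h_i x^i = \sum_{i=0}^d f_{i-1} x^i (1-x)^{d-i}$,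 where $f_{i}$ is the number of $i$-dimensional faces (and $f_{ -1}=1$). A $(d-1)$-dimensional complex is shellable if it is pure and its facets can be ordered $\tau_1,\ldots,\tau_r$ so that for each $1<i\le r$, the complex $\overline{\tau_i} \cap \bigcup_{j<i}\overline{\tau_j}$ is pure of dimension $d-2$, where $\overline{\tau}$ denotes the set of all subsets of $\tau$. The equality $h(\Gamma)=F(M)$ means $h_i = F_i$ for $0\le i\le d$ (with $F_i=0$ for $i>d$). -}

module Defs where

open import Data.Nat using (ℕ; zero; suc; _≤_; _<_; _∸_; _≟_)
import Data.Nat as ℕ
open import Data.Integer using (ℤ; +_; -[1+_]) renaming (_+_ to _+ℤ_; _*_ to _*ℤ_)
open import Data.Bool using (Bool; true; false; _∧_)
open import Data.Fin using (Fin; toℕ; _↑ʳ_)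
open import Data.Fin.Subset using (Subset; _⊆_; ∣_∣; inside; outside) renaming (⊥ to ∅)
open import Data.Vec using (Vec; []; _∷_; replicate; _++_; sum)
open import Data.List using (List; []; _∷_; length; filter; map; foldr; upTo)
  renaming (_++_ to _++ₗ_)
open import Data.List.Membership.Propositional using (_∈_)
open import Data.List.Relation.Unary.Unique.Propositional using (Unique)
open import Data.Product using (Σ; ∃; ∃-syntax; _×_)
open import Relation.Binary.PropositionalEquality using (_≡_; _≢_)
open import Relation.Nullary using (¬_)
open import Relation.Nullary.Decidable using (⌊_⌋)

-- The complex Λ(l; p_1, …, p_m) on the vertex set Fin n, n = l + Σ p_i.
-- Vertices 0..l-1 form V'; then P_1 (p_1 vertices), P_2, …, P_m in order.

blk : ∀ {m} (ps : Vec ℕ m) → Fin m → Subset (sum ps)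
blk (p ∷ ps) Fin.zero    = replicate p inside  ++ replicate (sum ps) outside
blk (p ∷ ps) (Fin.suc i) = replicate p outside ++ blk ps i

P : ∀ {m} (l : ℕ) (ps : Vec ℕ m) → Fin m → Subset (l ℕ.+ sum ps)
P l ps i = replicate l outside ++ blk ps i

ΛFace : ∀ {m} (l : ℕ) (ps : Vec ℕ m) → Subset (l ℕ.+ sum ps) → Set
ΛFace l ps σ = ∀ i → ¬ (P l ps i ⊆ σ)

record SimplicialComplex (n : ℕ) : Set where
  field
    face      : Subset n → Bool
    empty     : face ∅ ≡ true
    downClosed : ∀ σ τ → face σ ≡ true → τ ⊆ σ → face τ ≡ true
open SimplicialComplex public

IsFace : ∀ {n} → SimplicialComplex n → Subset n → Set
IsFace Γ σ = face Γ σ ≡ true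

SubcomplexOfΛ : ∀ {m} (l : ℕ) (ps : Vec ℕ m) → SimplicialComplex (l ℕ.+ sum ps) → Set
SubcomplexOfΛ l ps Γ = ∀ σ → IsFace Γ σ → ΛFace l ps σ

IsFacet : ∀ {n} → (Subset n → Set) → Subset n → Set
IsFacet C σ = C σ × (∀ ρ → C ρ → σ ⊆ ρ → ρ ≡ σ)

-- "of dimension k-1": all faces have ≤ k vertices and some face has k vertices
HasDim : ∀ {n} (k : ℕ) → (Subset n → Set) → Set
HasDim k C = (∀ σ → C σ → ∣ σ ∣ ≤ k) × (∃[ σ ] (C σ × ∣ σ ∣ ≡ k))

PureDim : ∀ {n} (k : ℕ) → (Subset n → Set) → Set
PureDim k C = HasDim k C × (∀ σ → IsFacet C σ → ∣ σ ∣ ≡ k)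

ShellInter : ∀ {n} (τs : List (Subset n)) → Fin (length τs) → Subset n → Set
ShellInter τs i σ = σ ⊆ Data.List.lookup τs i × ∃[ j ] (toℕ j < toℕ i × σ ⊆ Data.List.lookup τs j)

Shellable : ∀ {n} (d : ℕ) → SimplicialComplex n → Set
Shellable d Γ =
  PureDim d (IsFace Γ) ×
  ∃[ τs ] ( Unique τs
          × (∀ σ → σ ∈ τs → IsFacet (IsFace Γ) σ)
          × (∀ σ → IsFacet (IsFace Γ) σ → σ ∈ τs)
          × (∀ (i : Fin (length τs)) → 1 ≤ toℕ i → PureDim (d ∸ 1) (ShellInter τs i)))

allSubsets : ∀ n → List (Subset n)
allSubsets zero    = [] ∷ []
allSubsets (suc n) = map (outside ∷_) (allSubsets n) ++ₗ map (inside ∷_) (allSubsets n)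

-- number of faces with exactly i vertices  ( = f_{i-1} )
faceCount : ∀ {n} → SimplicialComplex n → ℕ → ℕ
faceCount {n} Γ i = length (filter (λ σ → face Γ σ Data.Bool.≟ true) (filter (λ σ → ∣ σ ∣ ≟ i) (allSubsets n)))

-- integer polynomials as coefficient lists (constant term first)
Poly : Set
Poly = List ℤ

_⊕_ : Poly → Poly → Poly
[] ⊕ q = q
(a ∷ p) ⊕ [] = a ∷ p
(a ∷ p) ⊕ (b ∷ q) = (a +ℤ b) ∷ (p ⊕ q)

scale : ℤ → Poly → Poly
scale c = map (c *ℤ_)

_⊗_ : Poly → Poly → Poly
[] ⊗ q = []
(a ∷ p) ⊗ q = scale a q ⊕ ((+ 0) ∷ (p ⊗ q))

pow : Poly → ℕ → Poly
pow p zero = (+ 1) ∷ []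
pow p (suc k) = p ⊗ pow p k

X : Poly
X = (+ 0) ∷ (+ 1) ∷ []

oneMinusX : Poly
oneMinusX = (+ 1) ∷ -[1+ 0 ] ∷ []

coeff : Poly → ℕ → ℤ
coeff [] k = + 0
coeff (a ∷ p) zero = a
coeff (a ∷ p) (suc k) = coeff p k

hPoly : ∀ {n} → ℕ → SimplicialComplex n → Poly
hPoly d Γ = foldr _⊕_ [] (map (λ i → scale (+ faceCount Γ i) (pow X i ⊗ pow oneMinusX (d ∸ i))) (upTo (ℕ.suc d)))

-- h_k of Γ regarded as a (d-1)-dimensional complex
hVec : ∀ {n} → ℕ → SimplicialComplex n → ℕ → ℤ
hVec d Γ k = coeff (hPoly d Γ) k

-- Multicomplexes: finite sets of monomials in N variables, given as
-- duplicate-free lists of exponent vectors.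

Divides : ∀ {N} → Vec ℕ N → Vec ℕ N → Set
Divides v u = ∀ i → Data.Vec.lookup v i ≤ Data.Vec.lookup u i

IsMulticomplex : ∀ {N} → List (Vec ℕ N) → Set
IsMulticomplex M = Unique M × M ≢ [] × (∀ u v → u ∈ M → Divides v u → v ∈ M)

-- M ⊆ S(∞^k, p_1-1, …, p_m-1): first k variables unbounded
InS : ∀ {m} (k : ℕ) (ps : Vec ℕ m) → List (Vec ℕ (k ℕ.+ m)) → Set
InS k ps M = ∀ u → u ∈ M → ∀ i → Data.Vec.lookup u (k ↑ʳ i) ≤ Data.Vec.lookup ps i ∸ 1

DegLe : ∀ {N} → List (Vec ℕ N) → ℕ → Set
DegLe M d = ∀ u → u ∈ M → sum u ≤ d

FVec : ∀ {N} → List (Vec ℕ N) → ℕ → ℕ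
FVec M i = length (filter (λ u → sum u ≟ i) M)

{-# OPTIONS --safe #-}

-- Put k = n - d - m. The complement of a facet of Γ will have n - d vertices and meet every P_i. Its
-- last vertex in P_i encodes the exponent of the i-th bounded variable, namely the number of vertices
-- of P_i behind it. The other k complement vertices are marks cutting the vertices before the last
-- ones into gaps, and the lengths of the gaps in front of the marks are the exponents of the k
-- unbounded variables. The vertices counted in this way form the restriction of the facet, so the
-- size of the restriction is the degree of the monomial.
--
-- Forcing a vertex v of the restriction out of the facet is repaired by putting a complement vertex
-- in. The effect on the monomial is to lower exponents, or to move exponent from a bounded to an
-- unbounded variable, or from an unbounded variable to a later one. Hence if M is closed under these
-- moves, the facets of the monomials of M, ordered lexicographically by the bounded exponents and
-- then the unbounded ones, are a shelling with these restrictions. The intervals between restriction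
-- and facet partition Γ, and each of them contributes X^(size of the restriction) to the h-polynomial.
--
-- Closure under the moves is achieved by compressing M with respect to pairs of variables, in the
-- manner of Clements and Lindström, which changes neither the F-vector nor the bounds.

module Submission where

open import Defs

-- Compression of a multicomplex along pairs of variables

module Compression where

  open import Data.Nat
  open import Data.Nat.Properties
  open import Data.Nat.Induction using (<-wellFounded; Acc; acc)
  open import Data.Nat.ListAction using () renaming (sum to ΣL)
  open import Data.Bool using (Bool; true; false; if_then_else_)
  open import Data.Fin using (Fin; zero; suc)
  import Data.Fin.Properties as Fin
  open import Data.Vec using (Vec; []; _∷_; lookup; _[_]≔_; sum)
  open import Data.Vec.Properties using (lookup∘update; lookup∘update′; ≡-dec; tabulate∘lookup; tabulate-cong)
  open import Data.List using (List; []; _∷_; map)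
  open import Data.List.Membership.Propositional using (_∈_; _∉_; find; lose)
  open import Data.List.Membership.Propositional.Properties using (∈-map⁺; ∈-map⁻)
  import Data.List.Membership.DecPropositional as DecMembership
  open import Data.List.Relation.Unary.Any using (Any; here; there; any?)
  open import Data.List.Relation.Unary.All as All using (All; []; _∷_)
  import Data.List.Relation.Unary.All.Properties as All
  open import Data.List.Relation.Unary.AllPairs using ([]; _∷_)
  open import Data.List.Relation.Unary.Unique.Propositional using (Unique)
  open import Data.Product using (∃; _×_; _,_; proj₁; proj₂)
  open import Data.Sum using (_⊎_; inj₁; inj₂)
  open import Function using (id; _∘_; case_of_)
  open import Relation.Binary.Definitions using (tri<; tri≈; tri>)
  open import Relation.Binary.PropositionalEquality
  open import Relation.Nullary using (¬_; Dec; yes; no; does; contradiction)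
  open import Relation.Nullary.Decidable using (_×-dec_; ¬?; dec-true; dec-false; decidable-stable)

  count : (ℕ → Bool) → ℕ → ℕ
  count p zero    = 0
  count p (suc n) = if p n then suc (count p n) else count p n

  count-≤ : ∀ p n → count p n ≤ n
  count-≤ p zero = z≤n
  count-≤ p (suc n) with p n
  ... | true  = s≤s (count-≤ p n)
  ... | false = m≤n⇒m≤1+n (count-≤ p n)

  count-suc : ∀ p n → count p n ≤ count p (suc n)
  count-suc p n with p n
  ... | true  = n≤1+n _
  ... | false = ≤-refl

  count-≤-suc : ∀ p n → count p (suc n) ≤ suc (count p n)
  count-≤-suc p n with p n
  ... | true  = ≤-refl
  ... | false = n≤1+n _

  count-mono : ∀ {p q} n → (∀ {t} → t < n → p t ≡ true → q t ≡ true) → count p n ≤ count q n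
  count-mono zero f = z≤n
  count-mono {p} {q} (suc n) f with p n in e
  ... | false = ≤-trans (count-mono n (f ∘ m≤n⇒m≤1+n)) (count-suc q n)
  ... | true rewrite f ≤-refl e = s≤s (count-mono n (f ∘ m≤n⇒m≤1+n))

  count-cong : ∀ {p q} n → (∀ t → p t ≡ q t) → count p n ≡ count q n
  count-cong zero    f = refl
  count-cong (suc n) f rewrite f n | count-cong n f = refl

  count-< : ∀ {p t n} → t < n → p t ≡ true → count p t < count p n
  count-< {p} {n = suc n} (s≤s t≤n) e with m≤n⇒m<n∨m≡n t≤n
  ... | inj₁ t<n  = <-≤-trans (count-< t<n e) (count-suc p n)
  ... | inj₂ refl rewrite e = ≤-refl

  count-full : ∀ {p} n → (∀ {t} → t < n → p t ≡ true) → count p n ≡ n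
  count-full zero    f = refl
  count-full (suc n) f rewrite f {n} ≤-refl = cong suc (count-full n (f ∘ m≤n⇒m≤1+n))

  count-select : ∀ p {r} n → r < count p n → ∃ λ t → t < n × p t ≡ true × count p t ≡ r
  count-select p (suc n) l with p n in e
  ... | false = let t , t<n , q = count-select p n l in t , m≤n⇒m≤1+n t<n , q
  ... | true with m≤n⇒m<n∨m≡n (s≤s⁻¹ l)
  ...   | inj₁ l' = let t , t<n , q = count-select p n l' in t , m≤n⇒m≤1+n t<n , q
  ...   | inj₂ refl = n , ≤-refl , e , refl

  -- The two-variable Clements–Lindström step. Position t stands for the monomial x^t y^(n-t), and q
  -- is a superset of the shadow of p in degree n - 1. If p contains x^n, the shadow is no smaller
  -- than p unless it is everything.
  count-shadow : ∀ {p q} n → (∀ {t} → t < n → p t ≡ true → q t ≡ true) →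
                 (∀ {t} → t < n → p (suc t) ≡ true → q t ≡ true) →
                 (∀ {t} → t < n → q t ≡ true) ⊎ count p (suc n) ≤ count q n
  count-shadow {p} {q} zero    f g = inj₁ λ ()
  count-shadow {p} {q} (suc n) f g with p (suc n) in e
  ... | false = inj₂ (count-mono (suc n) f)
  ... | true rewrite g ≤-refl e with p n in e'
  ...   | false = inj₂ (s≤s (count-mono n (f ∘ m≤n⇒m≤1+n)))
  ...   | true with count-shadow {p} {q} n (f ∘ m≤n⇒m≤1+n) (g ∘ m≤n⇒m≤1+n)
  ...     | inj₁ all = inj₁ λ t<sn → case m≤n⇒m<n∨m≡n (s≤s⁻¹ t<sn) of λ { (inj₁ l) → all l ; (inj₂ refl) → g ≤-refl e }
  ...     | inj₂ l rewrite e' = inj₂ (s≤s l)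

  private variable
    N : ℕ

  vec-ext : {u v : Vec ℕ N} → (∀ c → lookup u c ≡ lookup v c) → u ≡ v
  vec-ext {u = u} {v} e = trans (sym (tabulate∘lookup u)) (trans (tabulate-cong e) (tabulate∘lookup v))

  -- With all weights 1 this is the degree, so `weight-update` serves both the invariance of the
  -- degree and the termination of the compressions.
  weight : (Fin N → ℕ) → Vec ℕ N → ℕ
  weight ω []       = 0
  weight ω (x ∷ xs) = ω zero * x + weight (ω ∘ suc) xs

  weight-1 : (u : Vec ℕ N) → weight (λ _ → 1) u ≡ sum u
  weight-1 []       = refl
  weight-1 (x ∷ xs) = cong₂ _+_ (+-identityʳ x) (weight-1 xs)

  weight-update : ∀ ω (u : Vec ℕ N) c x → weight ω (u [ c ]≔ x) + ω c * lookup u c ≡ weight ω u + ω c * x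
  weight-update ω (y ∷ u) zero x = begin
    ω zero * x + w + ω zero * y   ≡⟨ +-comm (ω zero * x + w) _ ⟩
    ω zero * y + (ω zero * x + w) ≡⟨ cong (ω zero * y +_) (+-comm _ w) ⟩
    ω zero * y + (w + ω zero * x) ≡⟨ sym (+-assoc (ω zero * y) w _) ⟩
    ω zero * y + w + ω zero * x   ∎
    where open ≡-Reasoning
          w = weight (ω ∘ suc) u
  weight-update ω (y ∷ u) (suc c) x =
    trans (+-assoc (ω zero * y) _ _) (trans (cong (ω zero * y +_) (weight-update (ω ∘ suc) u c x))
      (sym (+-assoc (ω zero * y) _ _)))

  -- Divisibility is generated by lowering one exponent by one, so closure has to be checked only
  -- for such steps. The bound `k` on the degree makes the descent from `u` to `v` terminate.
  divides-closed : ∀ (Q : Vec ℕ N → Set) → (∀ z c → Q z → 1 ≤ lookup z c → Q (z [ c ]≔ (lookup z c ∸ 1))) →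
                   ∀ u v → Q u → Divides v u → Q v
  divides-closed Q step u v q d = go (sum u) u ≤-refl q d
    where
    go : ∀ k u → sum u ≤ k → Q u → Divides v u → Q v
    go k u l q d with Fin.any? (λ c → lookup v c <? lookup u c)
    ... | no n = subst Q (vec-ext λ c → ≤-antisym (≮⇒≥ λ l → n (c , l)) (d c)) q
    ... | yes (c , v<u) = shrink k l
      where
      u' = u [ c ]≔ (lookup u c ∸ 1)
      1≤ : 1 ≤ lookup u c
      1≤ = ≤-trans (s≤s z≤n) v<u
      sum' : suc (sum u') ≡ sum u
      sum' = +-cancelʳ-≡ (lookup u c ∸ 1) _ _ (begin
        suc (sum u') + (lookup u c ∸ 1)                     ≡⟨ sym (+-suc (sum u') _) ⟩
        sum u' + suc (lookup u c ∸ 1)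
          ≡⟨ cong₂ _+_ (sym (weight-1 u')) (trans (m+[n∸m]≡n 1≤) (sym (*-identityˡ _))) ⟩
        weight (λ _ → 1) u' + 1 * lookup u c                ≡⟨ weight-update (λ _ → 1) u c _ ⟩
        weight (λ _ → 1) u + 1 * (lookup u c ∸ 1)           ≡⟨ cong₂ _+_ (weight-1 u) (*-identityˡ _) ⟩
        sum u + (lookup u c ∸ 1)                            ∎)
        where open ≡-Reasoning
      d' : Divides v u'
      d' e with e Fin.≟ c
      ... | yes refl = subst (lookup v e ≤_) (sym (lookup∘update e u _)) (∸-monoˡ-≤ 1 v<u)
      ... | no n     = subst (lookup v e ≤_) (sym (lookup∘update′ n u _)) (d e)
      shrink : ∀ k → sum u ≤ k → Q v
      shrink zero    l = contradiction (subst (_≤ 0) (sym sum') l) λ ()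
      shrink (suc k) l = go k u' (s≤s⁻¹ (subst (_≤ suc k) (sym sum') l)) (step u c q 1≤) d'

  module Line (i j : Fin N) (i≢j : i ≢ j) where

    total : Vec ℕ N → ℕ
    total u = lookup u i + lookup u j

    -- These are the monomials of the same degree that agree with `u` outside the two variables.
    -- Only positions `t ≤ total u` are meaningful, since the subtraction is truncated.
    line : Vec ℕ N → ℕ → Vec ℕ N
    line u t = (u [ i ]≔ t) [ j ]≔ (total u ∸ t)

    line-i : ∀ u t → lookup (line u t) i ≡ t
    line-i u t = trans (lookup∘update′ i≢j (u [ i ]≔ t) _) (lookup∘update i u t)

    line-j : ∀ u t → lookup (line u t) j ≡ total u ∸ t
    line-j u t = lookup∘update j (u [ i ]≔ t) _

    line-other : ∀ u t {c} → c ≢ i → c ≢ j → lookup (line u t) c ≡ lookup u c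
    line-other u t c≢i c≢j = trans (lookup∘update′ c≢j (u [ i ]≔ t) _) (lookup∘update′ c≢i u t)

    total-line : ∀ u {t} → t ≤ total u → total (line u t) ≡ total u
    total-line u {t} l = trans (cong₂ _+_ (line-i u t) (line-j u t)) (m+[n∸m]≡n l)

    by-coordinate : {P : Fin N → Set} → P i → P j → (∀ c → c ≢ i → c ≢ j → P c) → ∀ c → P c
    by-coordinate pi pj po c with c Fin.≟ i | c Fin.≟ j
    ... | yes refl | _        = pi
    ... | no _     | yes refl = pj
    ... | no n     | no n'    = po c n n'

    line-line : ∀ u {t} t' → t ≤ total u → line (line u t) t' ≡ line u t'
    line-line u {t} t' l = vec-ext (by-coordinate
      (trans (line-i (line u t) t') (sym (line-i u t')))
      (trans (line-j (line u t) t') (trans (cong (_∸ t') (total-line u l)) (sym (line-j u t'))))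
      λ c n n' → trans (line-other (line u t) t' n n') (trans (line-other u t n n') (sym (line-other u t' n n'))))

    line-self : ∀ u → line u (lookup u i) ≡ u
    line-self u = vec-ext (by-coordinate (line-i u _) (trans (line-j u _) (m+n∸m≡n (lookup u i) _)) (λ c → line-other u _))

    weight-line : ∀ ω u t → weight ω (line u t) + (ω i * lookup u i + ω j * lookup u j) ≡
                            weight ω u + (ω i * t + ω j * (total u ∸ t))
    weight-line ω u t = begin
      weight ω (line u t) + (a + b)                      ≡⟨ cong (weight ω (line u t) +_) (+-comm a b) ⟩
      weight ω (line u t) + (b + a)                      ≡⟨ sym (+-assoc (weight ω (line u t)) b a) ⟩
      weight ω (line u t) + b + a
        ≡⟨ cong (λ z → weight ω (line u t) + ω j * z + a) (sym (lookup∘update′ (i≢j ∘ sym) u t)) ⟩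
      weight ω (line u t) + ω j * lookup (u [ i ]≔ t) j + a ≡⟨ cong (_+ a) (weight-update ω (u [ i ]≔ t) j _) ⟩
      weight ω (u [ i ]≔ t) + c + a                      ≡⟨ +-assoc (weight ω (u [ i ]≔ t)) c a ⟩
      weight ω (u [ i ]≔ t) + (c + a)                    ≡⟨ cong (weight ω (u [ i ]≔ t) +_) (+-comm c a) ⟩
      weight ω (u [ i ]≔ t) + (a + c)                    ≡⟨ sym (+-assoc (weight ω (u [ i ]≔ t)) a c) ⟩
      weight ω (u [ i ]≔ t) + a + c                      ≡⟨ cong (_+ c) (weight-update ω u i t) ⟩
      weight ω u + ω i * t + c                           ≡⟨ +-assoc (weight ω u) (ω i * t) c ⟩
      weight ω u + (ω i * t + c)                         ∎
      where
      open ≡-Reasoning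
      a = ω i * lookup u i
      b = ω j * lookup u j
      c = ω j * (total u ∸ t)

    sum-line : ∀ u {t} → t ≤ total u → sum (line u t) ≡ sum u
    sum-line u {t} l = +-cancelʳ-≡ (total u) _ _ (begin
      sum (line u t) + total u
        ≡⟨ cong₂ _+_ (sym (weight-1 (line u t))) (sym (cong₂ _+_ (*-identityˡ (lookup u i)) (*-identityˡ (lookup u j)))) ⟩
      weight (λ _ → 1) (line u t) + (1 * lookup u i + 1 * lookup u j) ≡⟨ weight-line (λ _ → 1) u t ⟩
      weight (λ _ → 1) u + (1 * t + 1 * (total u ∸ t))
        ≡⟨ cong₂ _+_ (weight-1 u) (trans (cong₂ _+_ (*-identityˡ t) (*-identityˡ (total u ∸ t))) (m+[n∸m]≡n l)) ⟩
      sum u + total u ∎)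
      where open ≡-Reasoning

    -- The units of exponent that leave variable `i` reappear at variable `j`, where each of them
    -- weighs less.
    weight-line-< : ∀ ω → ω j < ω i → ∀ u {t} → t < lookup u i → weight ω (line u t) < weight ω u
    weight-line-< ω ωj<ωi u {t} t<ui with m≤n⇒∃[o]m+o≡n t<ui
    ... | e , eq = +-cancelʳ-< x _ _ (begin-strict
        weight ω (line u t) + x  ≡⟨ weight-line ω u t ⟩
        weight ω u + (ω i * t + ω j * (total u ∸ t)) <⟨ +-monoʳ-< (weight ω u) gain ⟩
        weight ω u + x ∎)
      where
      open ≤-Reasoning
      x = ω i * lookup u i + ω j * lookup u j
      ui : lookup u i ≡ t + suc e
      ui = trans (sym eq) (sym (+-suc t e))
      rest : total u ∸ t ≡ suc e + lookup u j
      rest = trans (cong (λ z → z + lookup u j ∸ t) ui) (trans (cong (_∸ t) (+-assoc t (suc e) _)) (m+n∸m≡n t _))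
      gain : ω i * t + ω j * (total u ∸ t) < x
      gain = begin-strict
        ω i * t + ω j * (total u ∸ t)                    ≡⟨ cong (λ z → ω i * t + ω j * z) rest ⟩
        ω i * t + ω j * (suc e + lookup u j)             ≡⟨ cong (ω i * t +_) (*-distribˡ-+ (ω j) (suc e) _) ⟩
        ω i * t + (ω j * suc e + ω j * lookup u j)
          <⟨ +-monoʳ-< (ω i * t) (+-monoˡ-< (ω j * lookup u j) (*-monoˡ-< (suc e) ωj<ωi)) ⟩
        ω i * t + (ω i * suc e + ω j * lookup u j)       ≡⟨ sym (+-assoc (ω i * t) _ _) ⟩
        ω i * t + ω i * suc e + ω j * lookup u j
          ≡⟨ cong (_+ ω j * lookup u j) (sym (*-distribˡ-+ (ω i) t (suc e))) ⟩
        ω i * (t + suc e) + ω j * lookup u j             ≡⟨ cong (λ z → ω i * z + ω j * lookup u j) (sym ui) ⟩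
        x                                                ∎

    Divides-line : ∀ z z' t t' → (∀ c → c ≢ i → c ≢ j → lookup z' c ≤ lookup z c) →
                   t' ≤ t → total z' ∸ t' ≤ total z ∸ t → Divides (line z' t') (line z t)
    Divides-line z z' t t' d l l' = by-coordinate
      (subst₂ _≤_ (sym (line-i z' t')) (sym (line-i z t)) l)
      (subst₂ _≤_ (sym (line-j z' t')) (sym (line-j z t)) l')
      λ c n n' → subst₂ _≤_ (sym (line-other z' t' n n')) (sym (line-other z t n n')) (d c n n')

    -- Every set of monomials on a line of the multicomplex is replaced by the equally many monomials
    -- with the smallest exponents of the i-th variable.
    module Compress (M : List (Vec ℕ N)) (M-mc : IsMulticomplex M) where

      open DecMembership (≡-dec {A = ℕ} {n = N} _≟_) using (_∈?_)

      M-unique : Unique M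
      M-unique = proj₁ M-mc

      M-closed : ∀ {u v} → u ∈ M → Divides v u → v ∈ M
      M-closed = proj₂ (proj₂ M-mc) _ _

      mem : Vec ℕ N → Bool
      mem u = does (u ∈? M)

      mem⁺ : ∀ {u} → u ∈ M → mem u ≡ true
      mem⁺ {u} e = dec-true (u ∈? M) e

      mem⁻ : ∀ {u} → mem u ≡ true → u ∈ M
      mem⁻ {u} e with yes p ← u ∈? M = p

      mem-mono : ∀ u v → Divides v u → mem u ≡ true → mem v ≡ true
      mem-mono u v d e = mem⁺ (M-closed (mem⁻ e) d)

      present : Vec ℕ N → ℕ → Bool
      present u t = mem (line u t)

      rank : Vec ℕ N → ℕ
      rank u = count (present u) (lookup u i)

      φ : Vec ℕ N → Vec ℕ N
      φ u = line u (rank u)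

      M′ : List (Vec ℕ N)
      M′ = map φ M

      ui≤total : ∀ u → lookup u i ≤ total u
      ui≤total u = m≤m+n _ _

      rank≤total : ∀ u → rank u ≤ total u
      rank≤total u = ≤-trans (count-≤ _ _) (ui≤total u)

      full-count : Vec ℕ N → ℕ
      full-count z = count (present z) (suc (total z))

      present-line : ∀ u {t} → t ≤ total u → ∀ t' → present (line u t) t' ≡ present u t'
      present-line u l t' = cong mem (line-line u t' l)

      -- The members of `M` on one line have the ranks 0, 1, 2, ... without omission, so `M′` meets
      -- the line in an initial segment of length `full-count`. With the converse `∈M′⇐`, closure of
      -- `M′` becomes an inequality between counts on neighbouring lines.
      ∈M′⇒ : ∀ {z} → z ∈ M′ → lookup z i < full-count z
      ∈M′⇒ z∈ with ∈-map⁻ φ z∈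
      ... | u , u∈ , refl = begin-strict
        lookup (φ u) i                                  ≡⟨ line-i u _ ⟩
        rank u
          <⟨ count-< (s≤s (ui≤total u)) (mem⁺ (subst (_∈ M) (sym (line-self u)) u∈)) ⟩
        count (present u) (suc (total u))               ≡⟨ sym (count-cong _ (present-line u (rank≤total u))) ⟩
        count (present (φ u)) (suc (total u))
          ≡⟨ cong (count (present (φ u)) ∘ suc) (sym (total-line u (rank≤total u))) ⟩
        full-count (φ u)                                ∎
        where open ≤-Reasoning

      ∈M′⇐ : ∀ {z} → lookup z i < full-count z → z ∈ M′
      ∈M′⇐ {z} l with count-select (present z) _ l
      ... | t , s≤s t≤ , e , r = subst (_∈ M′) φu≡z (∈-map⁺ φ (mem⁻ e))
        where
        u = line z t
        rank-u : rank u ≡ lookup z i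
        rank-u = trans (cong (count (present u)) (line-i z t)) (trans (count-cong t (present-line z t≤)) r)
        φu≡z : φ u ≡ z
        φu≡z = trans (cong (line u) rank-u) (trans (line-line z _ t≤) (line-self z))

      -- Lowering a variable outside the pair compares two lines position by position. Lowering `i`
      -- costs one position and at most one member. Lowering `j` keeps the position, so the shadow
      -- must not lose even one member, and `count-shadow` is needed.
      M′-step : ∀ z c → z ∈ M′ → 1 ≤ lookup z c → z [ c ]≔ (lookup z c ∸ 1) ∈ M′
      M′-step z c z∈ 1≤ = ∈M′⇐ (by-coordinate {P = λ c → 1 ≤ lookup z c → Goal c} at-i at-j at-other c 1≤)
        where
        low : Fin N → Vec ℕ N
        low c = z [ c ]≔ (lookup z c ∸ 1)

        Goal : Fin N → Set
        Goal c = lookup (low c) i < full-count (low c)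

        z-count : lookup z i < full-count z
        z-count = ∈M′⇒ z∈

        same : ∀ c {e} → e ≢ c → lookup (low c) e ≡ lookup z e
        same c n = lookup∘update′ n z _

        below : ∀ c e → lookup (low c) e ≤ lookup z e
        below c e with e Fin.≟ c
        ... | yes refl = ≤-trans (≤-reflexive (lookup∘update e z _)) (m∸n≤m _ 1)
        ... | no n     = ≤-reflexive (same c n)

        at-other : ∀ c → c ≢ i → c ≢ j → 1 ≤ lookup z c → Goal c
        at-other c n n' _ = begin-strict
          lookup (low c) i   ≡⟨ same c (n ∘ sym) ⟩
          lookup z i         <⟨ z-count ⟩
          full-count z
            ≤⟨ count-mono (suc (total z)) (λ {t} _ →
              mem-mono (line z t) (line (low c) t) (Divides-line z (low c) t t (λ e _ _ → below c e) ≤-refl (≤-reflexive (cong (_∸ t) tot)))) ⟩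
          count (present (low c)) (suc (total z)) ≡⟨ cong (count (present (low c)) ∘ suc) (sym tot) ⟩
          full-count (low c) ∎
          where
          open ≤-Reasoning
          tot : total (low c) ≡ total z
          tot = cong₂ _+_ (same c (n ∘ sym)) (same c (n' ∘ sym))

        -- Lowering `i` or `j` leads to the same shorter line, which carries the shadow of the line
        -- of `z`: `keep` divides by the `j`-th variable and `pull` by the `i`-th.
        module OnLine (c : Fin N) (tot : total z ≡ suc (total (low c))) where
          keep : ∀ {t} → t < suc (total (low c)) → present z t ≡ true → present (low c) t ≡ true
          keep {t} _ = mem-mono (line z t) (line (low c) t) (Divides-line z (low c) t t (λ e _ _ → below c e) ≤-refl
            (∸-monoˡ-≤ t (≤-trans (n≤1+n _) (≤-reflexive (sym tot)))))
          pull : ∀ {t} → t < suc (total (low c)) → present z (suc t) ≡ true → present (low c) t ≡ true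
          pull {t} _ = mem-mono (line z (suc t)) (line (low c) t)
            (Divides-line z (low c) (suc t) t (λ e _ _ → below c e) (n≤1+n t)
            (≤-reflexive (sym (cong (_∸ suc t) tot))))
          z-count′ : lookup z i < count (present z) (suc (suc (total (low c))))
          z-count′ = subst (λ s → lookup z i < count (present z) (suc s)) tot z-count

        at-i : 1 ≤ lookup z i → Goal i
        at-i 1≤ = begin-strict
          lookup (low i) i   ≡⟨ lookup∘update i z _ ⟩
          lookup z i ∸ 1     <⟨ ≤-reflexive (m+[n∸m]≡n 1≤) ⟩
          lookup z i         ≤⟨ s≤s⁻¹ (≤-trans z-count′ (count-≤-suc (present z) (suc (total (low i))))) ⟩
          count (present z) (suc (total (low i))) ≤⟨ count-mono _ keep ⟩
          full-count (low i) ∎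
          where
          open ≤-Reasoning
          tot : total z ≡ suc (total (low i))
          tot = cong₂ _+_ (trans (sym (m+[n∸m]≡n 1≤)) (cong suc (sym (lookup∘update i z _)))) (sym (same i (i≢j ∘ sym)))
          open OnLine i tot

        at-j : 1 ≤ lookup z j → Goal j
        at-j 1≤ = subst (_< full-count (low j)) (sym (same j i≢j)) (goal (count-shadow (suc (total (low j))) keep pull))
          where
          tot : total z ≡ suc (total (low j))
          tot = trans (cong₂ _+_ (sym (same j i≢j)) (trans (sym (m+[n∸m]≡n 1≤)) (cong suc (sym (lookup∘update j z _)))))
                    (+-suc _ _)
          open OnLine j tot
          goal : _ → lookup z i < full-count (low j)
          -- If the shorter line is full, its count is its length, which exceeds every exponent
          -- occurring on it.
          goal (inj₁ all) = subst (lookup z i <_) (sym (count-full (suc (total (low j))) all))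
                              (s≤s (≤-trans (≤-reflexive (sym (same j i≢j))) (m≤m+n _ _)))
          goal (inj₂ l)   = <-≤-trans z-count′ l

      -- Monomials with the same image lie on the same line, and there the count grows whenever a
      -- member of `M` is passed, so distinct members have distinct ranks.
      φ-injective : ∀ {u v} → u ∈ M → v ∈ M → φ u ≡ φ v → u ≡ v
      φ-injective {u} {v} u∈ v∈ e = begin
        u                      ≡⟨ sym (line-self u) ⟩
        line u (lookup u i)    ≡⟨ cong (line u) same-i ⟩
        line u (lookup v i)    ≡⟨ same-line (lookup v i) ⟩
        line v (lookup v i)    ≡⟨ line-self v ⟩
        v                      ∎
        where
        open ≡-Reasoning
        same-line : ∀ t → line u t ≡ line v t
        same-line t = trans (sym (line-line u t (rank≤total u)))
          (trans (cong (λ w → line w t) e) (line-line v t (rank≤total v)))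
        same-rank : count (present u) (lookup u i) ≡ count (present u) (lookup v i)
        same-rank = trans (sym (line-i u _)) (trans (cong (λ w → lookup w i) e) (trans (line-i v _)
          (count-cong (lookup v i) (λ t → cong mem (sym (same-line t))))))
        same-i : lookup u i ≡ lookup v i
        same-i with <-cmp (lookup u i) (lookup v i)
        ... | tri≈ _ p _ = p
        ... | tri< l _ _ = contradiction same-rank (<⇒≢ (count-< l (mem⁺ (subst (_∈ M) (sym (line-self u)) u∈))))
        ... | tri> _ _ l = contradiction (sym same-rank)
                (<⇒≢ (count-< l (mem⁺ (subst (_∈ M) (sym (trans (same-line _) (line-self v))) v∈))))

      M′-unique : Unique M′
      M′-unique = go M id M-unique
        where
        go : ∀ xs → (∀ {x} → x ∈ xs → x ∈ M) → Unique xs → Unique (map φ xs)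
        go []       sub [] = []
        go (x ∷ xs) sub (x∉ ∷ un) =
          All.map⁺ (All.tabulate λ y∈ e → All.lookup x∉ y∈ (φ-injective (sub (here refl)) (sub (there y∈)) e)) ∷
            go xs (sub ∘ there) un

      M′-mc : IsMulticomplex M′
      M′-mc = M′-unique , (λ e → proj₁ (proj₂ M-mc) (map-[] M e)) , divides-closed (_∈ M′) M′-step
        where
        map-[] : ∀ xs → map φ xs ≡ [] → xs ≡ []
        map-[] [] _ = refl

      φ-sum : ∀ u → sum (φ u) ≡ sum u
      φ-sum u = sum-line u (rank≤total u)

      -- The rank never exceeds the exponent of variable `i`, so only variable `j` can gain. With
      -- `j` unbounded, the bounds of `S` survive.
      φ-≤ : ∀ u c → c ≢ j → lookup (φ u) c ≤ lookup u c
      φ-≤ u c c≢j with c Fin.≟ i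
      ... | yes refl = ≤-trans (≤-reflexive (line-i u _)) (count-≤ _ _)
      ... | no n     = ≤-reflexive (line-other u _ n c≢j)

      φ-weight-≤ : ∀ ω → ω j < ω i → ∀ u → weight ω (φ u) ≤ weight ω u
      φ-weight-≤ ω l u with m≤n⇒m<n∨m≡n (count-≤ (present u) (lookup u i))
      ... | inj₁ k = <⇒≤ (weight-line-< ω l u k)
      ... | inj₂ e = ≤-reflexive (cong (weight ω) (trans (cong (line u) e) (line-self u)))

      -- If the predecessor on the line is missing, the rank is strictly smaller than the exponent,
      -- so the monomial really moves.
      φ-weight-< : ∀ ω → ω j < ω i → ∀ u → 1 ≤ lookup u i → line u (lookup u i ∸ 1) ∉ M → weight ω (φ u) < weight ω u
      φ-weight-< ω l u 1≤ n = weight-line-< ω l u (<-≤-trans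
        (subst (λ k → count (present u) k < suc (lookup u i ∸ 1)) (m+[n∸m]≡n 1≤) missing) (≤-reflexive (m+[n∸m]≡n 1≤)))
        where
        missing : count (present u) (suc (lookup u i ∸ 1)) < suc (lookup u i ∸ 1)
        missing rewrite dec-false (line u (lookup u i ∸ 1) ∈? M) n = s≤s (count-≤ _ _)

  FVec-map : (φ : Vec ℕ N → Vec ℕ N) → (∀ u → sum (φ u) ≡ sum u) → ∀ M k → FVec (map φ M) k ≡ FVec M k
  FVec-map φ e []      k = refl
  FVec-map φ e (u ∷ M) k rewrite e u with does (sum u ≟ k)
  ... | true  = cong suc (FVec-map φ e M k)
  ... | false = FVec-map φ e M k

  total-weight : (Fin N → ℕ) → List (Vec ℕ N) → ℕ
  total-weight ω M = ΣL (map (weight ω) M)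

  total-weight-≤ : ∀ ω (φ : Vec ℕ N → Vec ℕ N) → (∀ u → weight ω (φ u) ≤ weight ω u) →
                   ∀ M → total-weight ω (map φ M) ≤ total-weight ω M
  total-weight-≤ ω φ l []      = z≤n
  total-weight-≤ ω φ l (u ∷ M) = +-mono-≤ (l u) (total-weight-≤ ω φ l M)

  total-weight-< : ∀ ω (φ : Vec ℕ N → Vec ℕ N) → (∀ u → weight ω (φ u) ≤ weight ω u) →
                   ∀ {M} → Any (λ u → weight ω (φ u) < weight ω u) M → total-weight ω (map φ M) < total-weight ω M
  total-weight-< ω φ l {u ∷ M} (here k)  = +-mono-<-≤ k (total-weight-≤ ω φ l M)
  total-weight-< ω φ l {u ∷ M} (there k) = +-mono-≤-< (l u) (total-weight-< ω φ l k)

  transfer : Fin N → Fin N → Vec ℕ N → Vec ℕ N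
  transfer i j u = (u [ i ]≔ (lookup u i ∸ 1)) [ j ]≔ suc (lookup u j)

  module Stabilise (ω : Fin N → ℕ) (Target : Fin N → Set) (target? : ∀ c → Dec (Target c)) where

    open DecMembership (≡-dec {A = ℕ} {n = N} _≟_) using (_∈?_)

    Stable : List (Vec ℕ N) → Set
    Stable M = ∀ {u i j} → u ∈ M → Target j → ω j < ω i → 1 ≤ lookup u i → transfer i j u ∈ M

    Violation : List (Vec ℕ N) → Vec ℕ N → Fin N → Fin N → Set
    Violation M u i j = Target j × ω j < ω i × 1 ≤ lookup u i × transfer i j u ∉ M

    violation? : ∀ M u i j → Dec (Violation M u i j)
    violation? M u i j = target? j ×-dec (ω j <? ω i ×-dec (1 ≤? lookup u i ×-dec ¬? (transfer i j u ∈? M)))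

    Stabilisation : List (Vec ℕ N) → List (Vec ℕ N) → Set
    Stabilisation M M' = IsMulticomplex M' × (∀ k → FVec M' k ≡ FVec M k) ×
      (∀ {u'} → u' ∈ M' → ∃ λ u → u ∈ M × sum u' ≡ sum u × ∀ c → ¬ Target c → lookup u' c ≤ lookup u c)

    -- A missing transfer calls for the compression of its pair of variables. This moves at least
    -- the offending monomial and strictly lowers the total weight, so the process ends, and it ends
    -- only when no transfer is missing.
    stabilise : ∀ M → IsMulticomplex M → ∃ λ M' → Stabilisation M M' × Stable M'
    stabilise M mc = go M mc (<-wellFounded (total-weight ω M))
      where
      go : ∀ M → IsMulticomplex M → Acc _<_ (total-weight ω M) → ∃ λ M' → Stabilisation M M' × Stable M'
      go M mc (acc rs) with any? (λ u → Fin.any? (λ i → Fin.any? (λ j → violation? M u i j))) M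
      ... | no n = M , (mc , (λ _ → refl) , λ {u} u∈ → u , u∈ , refl , λ _ _ → ≤-refl) ,
        λ {u} {i} {j} u∈ tj l 1≤ → decidable-stable (transfer i j u ∈? M) λ t∉ → n (lose u∈ (i , j , tj , l , 1≤ , t∉))
      ... | yes v with find v
      ... | u , u∈ , i , j , tj , l , 1≤ , t∉ =
        let M'' , (mc'' , f'' , b'') , st = go M′ M′-mc (rs smaller)
        in M'' , (mc'' , (λ k → trans (f'' k) (FVec-map φ φ-sum M k)) , λ u'∈ →
             let u' , u'∈M′ , s , b = b'' u'∈ ; w , w∈ , e = ∈-map⁻ φ u'∈M′ in
             w , w∈ , trans s (trans (cong sum e) (φ-sum w)) ,
             λ c nt → ≤-trans (b c nt) (≤-trans (≤-reflexive (cong (λ x → lookup x c) e)) (φ-≤ w c λ { refl → nt tj }))) , st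
        where
        i≢j : i ≢ j
        i≢j refl = <-irrefl refl l
        open Line i j i≢j
        open Compress M mc
        -- The missing transfer is the predecessor of `u` on its line, as `φ-weight-<` requires.
        transfer≡ : transfer i j u ≡ line u (lookup u i ∸ 1)
        transfer≡ = cong (λ x → (u [ i ]≔ (lookup u i ∸ 1)) [ j ]≔ x) (sym (begin
          lookup u i + lookup u j ∸ (lookup u i ∸ 1)
            ≡⟨ cong (λ x → x + lookup u j ∸ (lookup u i ∸ 1)) (sym (m∸n+n≡m 1≤)) ⟩
          lookup u i ∸ 1 + 1 + lookup u j ∸ (lookup u i ∸ 1)
            ≡⟨ cong (_∸ (lookup u i ∸ 1)) (+-assoc (lookup u i ∸ 1) 1 _) ⟩
          lookup u i ∸ 1 + suc (lookup u j) ∸ (lookup u i ∸ 1)       ≡⟨ m+n∸m≡n (lookup u i ∸ 1) _ ⟩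
          suc (lookup u j)                                           ∎))
          where open ≡-Reasoning
        smaller : total-weight ω M′ < total-weight ω M
        smaller = total-weight-< ω φ (φ-weight-≤ ω l)
          (lose u∈ (φ-weight-< ω l u 1≤ (λ e → t∉ (subst (_∈ M) (sym transfer≡) e))))

-- Words encoding facets with their restrictions, and the exchange of a vertex

module Words where

  open import Data.Nat
  open import Data.Nat.Properties
  open import Data.Bool using (Bool)
  open import Data.Fin using (Fin; zero; suc)
  open import Data.Fin.Subset using (Subset; inside; outside; _⊆_; ∣_∣; _∈_)
  open import Data.Fin.Subset.Properties using (drop-∷-⊆; s⊆s; out⊆)
  open import Data.Vec using (Vec; []; _∷_; here; there; sum; replicate; _++_)
  open import Data.List as List using (List; []; _∷_; length)
  open import Data.Nat.ListAction using () renaming (sum to ΣL)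
  open import Data.List.Relation.Binary.Lex.Strict using (Lex-<)
  open import Data.List.Relation.Binary.Lex.Core using (this; next)
  open import Data.Product
  open import Data.Sum using (_⊎_; inj₁; inj₂)
  open import Data.Empty using (⊥-elim)
  open import Function using (id; _∘_)
  open import Relation.Binary.Construct.Closure.Transitive using (TransClosure; [_]; _∷_) renaming (_++_ to _◅◅_)
  open import Relation.Binary.PropositionalEquality
  open import Relation.Nullary using (¬_)

  variable
    m r y y' p g h δ : ℕ
    ps : Vec ℕ m
    gs gs' gs₀ ys ys' : List ℕ
    b c : Bool

  data Mode : Set where
    free tail : Mode
    pend      : ℕ → Mode

  -- Letters charged to the gaps are read in an `Open` mode, and a block may end only in a `Closed`
  -- one. Thus every block has to pass through `last`, whereas `V'`, read in mode `free`, needs no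
  -- such vertex.
  data Open : Mode → Set where
    free : Open free
    pend : Open (pend y)

  data Closed : Mode → Set where
    free : Closed free
    tail : Closed tail

  variable
    μ μ' : Mode

  -- Facets and their restrictions are read off from left to right. In Word μ r ps gs ys σ ρ there are
  -- r vertices left in the current block, followed by the blocks ps; σ is the facet and ρ its
  -- restriction. A vertex outside σ ends a gap (mark) unless it is the last such vertex of its block
  -- (last). The list gs holds the lengths of the remaining gaps, where vertices after the last mark
  -- are not counted (skip), and ys holds for every remaining block the number of vertices behind its
  -- last vertex outside σ. The mode is free inside V', pend y before the last complement vertex of a
  -- block with y vertices behind it, and tail after it.

  data Step : Bool → Bool → List ℕ → List ℕ → Set where
    skip : Step inside outside [] []
    tick : Step inside inside (suc g ∷ gs) (g ∷ gs)
    mark : Step outside outside (0 ∷ gs) gs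

  data Word : Mode → (r : ℕ) (ps : Vec ℕ m) → List ℕ → List ℕ →
              Subset (r + sum ps) → Subset (r + sum ps) → Set where
    end    : Closed μ → Word μ 0 [] [] [] [] []
    block  : ∀ {σ ρ} → Closed μ → Word (pend y) p ps gs ys σ ρ →
             Word μ 0 (p ∷ ps) gs (y ∷ ys) σ ρ
    letter : ∀ {σ ρ} → Open μ → Step b c gs gs' → Word μ r ps gs' ys σ ρ →
             Word μ (suc r) ps gs ys (b ∷ σ) (c ∷ ρ)
    last   : ∀ {σ ρ} → Word tail y ps gs ys σ ρ →
             Word (pend y) (suc y) ps gs ys (outside ∷ σ) (outside ∷ ρ)
    after  : ∀ {σ ρ} → Word tail r ps gs ys σ ρ →
             Word tail (suc r) ps gs ys (inside ∷ σ) (inside ∷ ρ)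

  State : Set
  State = List ℕ × List ℕ

  data _↓_ : List ℕ → List ℕ → Set where
    here  : (suc y ∷ ys) ↓ (y ∷ ys)
    there : ys ↓ ys' → (y ∷ ys) ↓ (y ∷ ys')

  -- The elementary changes of exponents caused by forcing a vertex of the restriction out.
  data Move : State → State → Set where
    drop  : Move (suc g ∷ gs , ys) (g ∷ gs , ys)
    shift : Move (suc g ∷ h ∷ gs , ys) (g ∷ suc h ∷ gs , ys)
    lower : ys ↓ ys' → Move (gs , ys) (gs , ys')
    trade : ys ↓ ys' → Move (g ∷ gs , ys) (suc g ∷ gs , ys')
    there : Move (gs , ys) (gs' , ys') → Move (g ∷ gs , ys) (g ∷ gs' , ys')

  Moves : State → State → Set
  Moves = TransClosure Move

  -- One more facet vertex in front lengthens the first gap; behind the last mark it is not counted.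
  bump : List ℕ → List ℕ
  bump []       = []
  bump (g ∷ gs) = suc g ∷ gs

  bump-Move : ∀ {s s'} → Move s s' →
              Move (bump (proj₁ s) , proj₂ s) (bump (proj₁ s') , proj₂ s')
  bump-Move drop                = drop
  bump-Move shift               = shift
  bump-Move {[] , _} (lower q)    = lower q
  bump-Move {_ ∷ _ , _} (lower q) = lower q
  bump-Move (trade q)           = trade q
  bump-Move (there q)           = there q

  map⁺ : (f : State → State) → (∀ {s s'} → Move s s' → Move (f s) (f s')) →
         ∀ {s s'} → Moves s s' → Moves (f s) (f s')
  map⁺ f F [ q ]    = [ F q ]
  map⁺ f F (q ∷ qs) = F q ∷ map⁺ f F qs

  cons-Move : ∀ {s s'} → Move s s' → Move (proj₁ s , y ∷ proj₂ s) (proj₁ s' , y ∷ proj₂ s')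
  cons-Move drop      = drop
  cons-Move shift     = shift
  cons-Move (lower q) = lower (there q)
  cons-Move (trade q) = trade (there q)
  cons-Move (there q) = there (cons-Move q)

  tick-in : ∀ gs → ∃ λ c → Step inside c (bump gs) gs
  tick-in []       = outside , skip
  tick-in (g ∷ gs) = inside , tick

  tick-in′ : gs' ≡ bump gs → ∃ λ c → Step inside c gs' gs
  tick-in′ {gs = gs} refl = tick-in gs

  Step-Moves : ∀ {gs₁} → Step b c gs gs' → Moves (gs' , ys) (gs₁ , ys') →
           ∃₂ λ c' gs₀ → Step b c' gs₀ gs₁ × Moves (gs , ys) (gs₀ , ys')
  Step-Moves {gs₁ = gs₁} skip q = let c , s = tick-in gs₁ in c , _ , s , map⁺ (map₁ bump) bump-Move q
  Step-Moves {gs₁ = gs₁} tick q = let c , s = tick-in gs₁ in c , _ , s , map⁺ (map₁ bump) bump-Move q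
  Step-Moves mark q = outside , _ , mark , map⁺ (map₁ (0 ∷_)) there q

  -- Removing a mark joins the gaps `g` and `h` around it, and the former mark is the additional
  -- vertex. If no mark follows, the joined stretch is no longer counted.
  merge : ℕ → List ℕ → List ℕ
  merge g []       = []
  merge g (h ∷ hs) = suc (g + h) ∷ hs

  bump-merge : ∀ gs → bump (merge g gs) ≡ merge (suc g) gs
  bump-merge []       = refl
  bump-merge (_ ∷ _) = refl

  bump≡merge0 : ∀ gs → bump gs ≡ merge 0 gs
  bump≡merge0 []       = refl
  bump≡merge0 (_ ∷ _) = refl

  -- Puts the first marked vertex into the facet, which joins the two gaps around it.
  fill : ∀ {σ ρ} → Word μ r ps (g ∷ gs) ys σ ρ →
         ∃₂ λ σ' ρ' → Word μ r ps (merge g gs) ys σ' ρ' × σ ⊆ σ'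
  fill (block k w) = let _ , _ , w' , q = fill w in _ , _ , block k w' , q
  fill {gs = gs} (letter o tick w) =
    let _ , _ , w' , q = fill w
        _ , s = tick-in′ (sym (bump-merge gs))
    in _ , _ , letter o s w' , s⊆s q
  fill {gs = gs} (letter o mark w) =
    let _ , s = tick-in′ (sym (bump≡merge0 gs))
    in _ , _ , letter o s w , out⊆ id
  fill (last w) = let _ , _ , w' , q = fill w in _ , _ , last w' , s⊆s q
  fill (after w) = let _ , _ , w' , q = fill w in _ , _ , after w' , s⊆s q

  -- In mode `pend y` the entry of the current block has already left `ys`. It is restored here
  -- because an exchange may lower it.
  full : Mode → List ℕ → List ℕ
  full free ys     = ys
  full tail ys     = ys
  full (pend y) ys = y ∷ ys

  full-Closed : Closed μ → full μ ys ≡ ys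
  full-Closed free = refl
  full-Closed tail = refl

  -- The values in `pend` may differ, since an exchange can relocate the last complement vertex of
  -- the current block.
  data _∼_ : Mode → Mode → Set where
    free : free ∼ free
    tail : tail ∼ tail
    pend : pend y ∼ pend y'

  open-∼ : Open μ → μ ∼ μ' → Open μ'
  open-∼ free free = free
  open-∼ pend pend = pend

  refl-∼ : ∀ μ → μ ∼ μ
  refl-∼ free = free
  refl-∼ tail = tail
  refl-∼ (pend _) = pend

  _⊆[_]_ : ∀ {n} → Subset n → Fin n → Subset n → Set
  σ ⊆[ v ] σ' = ∀ {x} → x ∈ σ → x ≢ v → x ∈ σ'

  ∷-⊆[] : ∀ {n} {σ σ' : Subset n} {v} → σ ⊆[ v ] σ' → (b ∷ σ) ⊆[ suc v ] (b ∷ σ')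
  ∷-⊆[] q here      _ = here
  ∷-⊆[] q (there e) n = there (q e (n ∘ cong suc))

  here-⊆[] : ∀ {n} {σ σ' : Subset n} → σ ⊆ σ' → (b ∷ σ) ⊆[ zero ] (c ∷ σ')
  here-⊆[] q here      n = ⊥-elim (n refl)
  here-⊆[] q (there e) n = there (q e)

  out-⊆[] : ∀ {n} {σ σ' : Subset n} {v} → σ ⊆[ v ] σ' → (outside ∷ σ) ⊆[ suc v ] (b ∷ σ')
  out-⊆[] q (there e) n = there (q e (n ∘ cong suc))

  Exchange : Mode → (r : ℕ) (ps : Vec ℕ m) → List ℕ → List ℕ → Subset (r + sum ps) → Fin (r + sum ps) → Set
  Exchange μ r ps gs ys σ v = ∃₂ λ μ' gs' → ∃₂ λ ys' σ' → ∃ λ ρ' →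
    μ ∼ μ' × Word μ' r ps gs' ys' σ' ρ' × Moves (gs , full μ ys) (gs' , full μ' ys') × σ ⊆[ v ] σ'

  iter : ℕ → List ℕ → List ℕ
  iter zero    gs = gs
  iter (suc δ) gs = bump (iter δ gs)

  iter-[] : ∀ δ → iter δ [] ≡ []
  iter-[] zero    = refl
  iter-[] (suc δ) = cong bump (iter-[] δ)

  iter-∷ : ∀ δ → iter δ (g ∷ gs) ≡ δ + g ∷ gs
  iter-∷ zero    = refl
  iter-∷ (suc δ) = cong bump (iter-∷ δ)

  lower-y : ∀ δ → Moves (gs , suc (y + δ) ∷ ys) (gs , y ∷ ys)
  lower-y {y = y} zero rewrite +-identityʳ y = [ lower here ]
  lower-y {y = y} (suc δ) rewrite +-suc y δ  = lower here ∷ lower-y δ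

  trade-y : ∀ δ → Moves (h ∷ gs , suc (y + δ) ∷ ys) (δ + suc h ∷ gs , y ∷ ys)
  trade-y {y = y} zero rewrite +-identityʳ y = [ trade here ]
  trade-y {h = h} {y = y} (suc δ) rewrite +-suc y δ | sym (+-suc δ (suc h)) = trade here ∷ trade-y δ

  lower-iter : ∀ δ → Moves ([] , suc (y + δ) ∷ ys) (bump (iter δ []) , y ∷ ys)
  lower-iter δ rewrite iter-[] δ = lower-y δ

  drops : ∀ g → Moves (suc g ∷ gs , ys) (0 ∷ gs , ys)
  drops zero    = [ drop ]
  drops (suc g) = drop ∷ drops g

  shifts : ∀ g h → Moves (suc g ∷ h ∷ gs , ys) (0 ∷ suc (g + h) ∷ gs , ys)
  shifts zero    h = [ shift ]
  shifts (suc g) h rewrite sym (+-suc g h) = shift ∷ shifts g (suc h)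

  merge-moves : ∀ gs → Moves (suc g ∷ gs , ys) (0 ∷ merge g gs , ys)
  merge-moves []       = drops _
  merge-moves (h ∷ gs) = shifts _ h

  -- The remainder `g` of the current gap passes to the next gap, followed by the `suc δ` units that
  -- the block loses. If there is no next gap, both are dropped.
  swap-moves : ∀ g δ gs → Moves (g ∷ gs , suc (y + δ) ∷ ys) (0 ∷ iter δ (merge g gs) , y ∷ ys)
  swap-moves zero δ [] rewrite iter-[] δ = lower-y δ
  swap-moves (suc g) δ [] rewrite iter-[] δ = drops g ◅◅ lower-y δ
  swap-moves g δ (h ∷ hs) rewrite iter-∷ {suc (g + h)} {hs} δ with g
  ... | zero  = map⁺ (map₁ (0 ∷_)) there (trade-y δ)
  ... | suc g = shifts g h ◅◅ map⁺ (map₁ (0 ∷_)) there (trade-y δ)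

  -- If v lies in the current block, it becomes the last complement vertex of this block, which is
  -- preceded by δ further vertices of the facet and followed by y of them. The former last complement
  -- vertex has been read already, and the gaps behind v may still be changed from gs to gs₀.
  tail-exchange : ∀ {σ ρ v} →
    (∀ {r} {σ ρ : Subset (r + sum ps)} → Word tail r ps gs ys σ ρ →
       ∃₂ λ σ' ρ' → Word tail r ps gs₀ ys σ' ρ' × σ ⊆ σ') →
    Word tail r ps gs ys σ ρ → v ∈ ρ →
    Exchange tail r ps gs ys σ v ⊎
    ∃₂ λ y δ → r ≡ suc (y + δ) × ∃₂ λ σ' ρ' → Word (pend y) r ps (iter δ gs₀) ys σ' ρ' × σ ⊆[ v ] σ'

  exchange : ∀ {σ ρ v} → Open μ → Word μ r ps gs ys σ ρ → v ∈ ρ → Exchange μ r ps gs ys σ v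

  block-exchange : ∀ {σ ρ v} → Closed μ → Word (pend y) p ps gs ys σ ρ → v ∈ ρ →
                   Exchange μ 0 (p ∷ ps) gs (y ∷ ys) σ v

  tail-exchange f (end _) ()
  tail-exchange f (block k w) e = inj₁ (block-exchange k w e)
  tail-exchange f (letter () _ _)
  tail-exchange f (after {r = r} w) here =
    let _ , _ , w' , q = f w
    in inj₂ (r , 0 , cong suc (sym (+-identityʳ r)) , _ , _ , last w' , here-⊆[] q)
  tail-exchange f (after w) (there e) with tail-exchange f w e
  ... | inj₁ (_ , _ , _ , _ , _ , tail , w' , q , i) = inj₁ (_ , _ , _ , _ , _ , tail , after w' , q , ∷-⊆[] i)
  ... | inj₂ (y , δ , refl , _ , _ , w' , i) =
    inj₂ (y , suc δ , cong suc (sym (+-suc y δ)) , _ , _ , letter pend (proj₂ (tick-in _)) w' , ∷-⊆[] i)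

  block-exchange k w e with exchange pend w e
  ... | _ , _ , _ , _ , _ , pend , w' , q , i =
    _ , _ , _ , _ , _ , refl-∼ _ , block k w' ,
    subst₂ (λ a b → Moves (_ , a) (_ , b)) (sym (full-Closed k)) (sym (full-Closed k)) q , i

  exchange free (block k w) e = block-exchange k w e
  -- `v` becomes a mark, ending its gap at once, and the next mark is filled in return.
  exchange {gs = suc _ ∷ gs} _ (letter {μ = μ} o tick w) here =
    let _ , _ , w' , q = fill w
    in μ , _ , _ , _ , _ , refl-∼ μ , letter o mark w' , merge-moves gs , here-⊆[] q
  exchange _ (letter o s w) (there e) with exchange o w e
  ... | _ , _ , _ , _ , _ , k , w' , q , i with Step-Moves s q
  ... | _ , _ , s' , q' = _ , _ , _ , _ , _ , k , letter (open-∼ o k) s' w' , q' , ∷-⊆[] i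
  exchange {gs = []} _ (last w) (there e) with tail-exchange (λ w → _ , _ , w , id) w e
  ... | inj₁ (_ , _ , _ , _ , _ , tail , w' , q , i) =
    _ , _ , _ , _ , _ , pend , last w' , map⁺ (map₂ (_ ∷_)) cons-Move q , ∷-⊆[] i
  -- No mark is left to be filled, so the former last complement vertex itself enters the facet.
  ... | inj₂ (y , δ , refl , _ , _ , w' , i) =
    _ , _ , _ , _ , _ , pend , letter pend (proj₂ (tick-in _)) w' ,
    lower-iter δ , out-⊆[] i
  exchange {gs = g ∷ gs} _ (last w) (there e) with tail-exchange fill w e
  ... | inj₁ (_ , _ , _ , _ , _ , tail , w' , q , i) =
    _ , _ , _ , _ , _ , pend , last w' , map⁺ (map₂ (_ ∷_)) cons-Move q , ∷-⊆[] i
  -- The former last complement vertex becomes a mark and replaces the first mark behind `v`, which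
  -- has been filled.
  ... | inj₂ (y , δ , refl , _ , _ , w' , i) =
    _ , _ , _ , _ , _ , pend , letter pend mark w' , swap-moves g δ gs , ∷-⊆[] i

  -- Lexicographic comparison of words

  _≺_ : List ℕ → List ℕ → Set
  _≺_ = Lex-< _≡_ _<_

  pend-bound : ∀ {σ ρ} → Word (pend y) r ps gs ys σ ρ → y < r
  pend-bound (block () _)
  pend-bound (end ())
  pend-bound (letter _ _ w) = m≤n⇒m≤1+n (pend-bound w)
  pend-bound (last w)       = ≤-refl

  -- In mode `tail` the restriction contains the whole rest of the block, while in mode `pend` some
  -- vertex of this rest is still to be left out of the facet.
  tail⊈pend : ∀ {σ ρ σ' ρ'} → Word tail r ps gs ys σ ρ → Word (pend y') r ps gs' ys' σ' ρ' → ¬ ρ ⊆ σ'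
  tail⊈pend (letter () _ _) w' q
  tail⊈pend (end _) (end ()) q
  tail⊈pend (block _ _) (block () _) q
  tail⊈pend (after w) (letter _ _ w') q = tail⊈pend w w' (drop-∷-⊆ q)
  tail⊈pend (after w) (last w') q with q here
  ... | ()

  -- The vertices behind the last complement vertex of the first word lie in its restriction, so the
  -- second word cannot have its own last complement vertex among them.
  pend-mono : ∀ {σ ρ σ' ρ'} → Word (pend y) r ps gs ys σ ρ → Word (pend y') r ps gs' ys' σ' ρ' → ρ ⊆ σ' → y ≤ y'
  pend-mono (end ()) w' q
  pend-mono (block () _) w' q
  pend-mono (letter _ _ w) (letter _ _ w') q = pend-mono w w' (drop-∷-⊆ q)
  pend-mono (letter _ _ w) (last w') q = <⇒≤ (pend-bound w)
  pend-mono (last w) (letter _ _ w') q = ⊥-elim (tail⊈pend w w' (drop-∷-⊆ q))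
  pend-mono (last w) (last w') q = ≤-refl

  unfold : ∀ {σ ρ} → Word μ (suc r) ps gs ys (b ∷ σ) (c ∷ ρ) → ∃₂ λ μ' gs' → Word μ' r ps gs' ys σ ρ
  unfold (letter _ _ w) = _ , _ , w
  unfold (last w)       = _ , _ , w
  unfold (after w)      = _ , _ , w

  -- The first block with different entries decides, by `pend-mono`. Marks do not matter, so modes
  -- and gaps of the two words are unrelated, and the strict case holds whatever gaps are appended.
  ys-mono : ∀ r (ps : Vec ℕ m) {μ μ' gs gs'} {σ ρ σ' ρ'} → Word μ r ps gs ys σ ρ → Word μ' r ps gs' ys' σ' ρ' →
            ρ ⊆ σ' → ys ≡ ys' ⊎ (∀ {gs gs'} → (ys List.++ gs) ≺ (ys' List.++ gs'))
  ys-mono zero [] (end _) (end _) q = inj₁ refl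
  ys-mono zero (p ∷ ps) (block _ w) (block _ w') q with m≤n⇒m<n∨m≡n (pend-mono w w' q)
  ... | inj₁ y<y' = inj₂ (this y<y')
  ... | inj₂ refl with ys-mono p ps w w' q
  ...   | inj₁ refl = inj₁ refl
  ...   | inj₂ l    = inj₂ (next refl l)
  ys-mono (suc r) ps {σ = _ ∷ _} {_ ∷ _} {_ ∷ _} {_ ∷ _} w w' q =
    let _ , _ , u = unfold w ; _ , _ , u' = unfold w' in ys-mono r ps u u' (drop-∷-⊆ q)

  bump-≺ : ∀ {g g'} → (g ∷ gs) ≡ (g' ∷ gs') ⊎ (g ∷ gs) ≺ (g' ∷ gs') →
           (suc g ∷ gs) ≡ (suc g' ∷ gs') ⊎ (suc g ∷ gs) ≺ (suc g' ∷ gs')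
  bump-≺ (inj₁ refl)          = inj₁ refl
  bump-≺ (inj₂ (this l))      = inj₂ (this (s≤s l))
  bump-≺ (inj₂ (next refl l)) = inj₂ (next refl l)

  -- With equal `ys` the last complement vertices stand at the same places. Where the words first
  -- differ, a `tick` against a `mark` would violate `ρ ⊆ σ'`, so the first word has the mark and
  -- thus the shorter gap. Equal lengths keep `skip` from meeting another letter.
  gs-mono : ∀ {σ ρ σ' ρ'} → Word μ r ps gs ys σ ρ → Word μ r ps gs' ys σ' ρ' →
            length gs ≡ length gs' → ρ ⊆ σ' → gs ≡ gs' ⊎ gs ≺ gs'
  gs-mono {gs = []} {gs' = []} w w' l q = inj₁ refl
  gs-mono (block _ w) (block _ w') l q = gs-mono w w' l q
  gs-mono (letter _ tick w) (letter _ tick w') l q = bump-≺ (gs-mono w w' l (drop-∷-⊆ q))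
  gs-mono (letter _ tick w) (letter _ mark w') l q with q here
  ... | ()
  gs-mono (letter _ mark w) (letter _ tick w') l q = inj₂ (this z<s)
  gs-mono (letter _ mark w) (letter _ mark w') l q with gs-mono w w' (suc-injective l) (drop-∷-⊆ q)
  ... | inj₁ refl = inj₁ refl
  ... | inj₂ k    = inj₂ (next refl k)
  gs-mono (letter _ _ w) (last _) l q = ⊥-elim (<-irrefl refl (pend-bound w))
  gs-mono (last _) (letter _ _ w') l q = ⊥-elim (<-irrefl refl (pend-bound w'))
  gs-mono (last w) (last w') l q = gs-mono w w' l (drop-∷-⊆ q)
  gs-mono (after w) (after w') l q = gs-mono w w' l (drop-∷-⊆ q)

  ++-≺ : ∀ zs {xs xs'} → xs ≺ xs' → (zs List.++ xs) ≺ (zs List.++ xs')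
  ++-≺ []       k = k
  ++-≺ (_ ∷ zs) k = next refl (++-≺ zs k)

  -- This yields the shelling order: a restriction lies only in its own facet and possibly in facets
  -- with larger keys.
  word-mono : ∀ {σ ρ σ' ρ'} → Word μ r ps gs ys σ ρ → Word μ r ps gs' ys' σ' ρ' →
              length gs ≡ length gs' → ρ ⊆ σ' →
              (gs ≡ gs' × ys ≡ ys') ⊎ (ys List.++ gs) ≺ (ys' List.++ gs')
  word-mono {ys = ys} w w' l q with ys-mono _ _ w w' q
  ... | inj₂ k = inj₂ k
  ... | inj₁ refl with gs-mono w w' l q
  ...   | inj₁ refl = inj₁ (refl , refl)
  ...   | inj₂ k    = inj₂ (++-≺ ys k)

  -- Cardinalities of words, and the vertices missed in each block

  ρ⊆σ : ∀ {σ ρ} → Word μ r ps gs ys σ ρ → ρ ⊆ σ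
  ρ⊆σ (end _)              = id
  ρ⊆σ (block _ w)          = ρ⊆σ w
  ρ⊆σ (letter _ skip w)    = out⊆ (ρ⊆σ w)
  ρ⊆σ (letter _ tick w)    = s⊆s (ρ⊆σ w)
  ρ⊆σ (letter _ mark w)    = s⊆s (ρ⊆σ w)
  ρ⊆σ (last w)             = s⊆s (ρ⊆σ w)
  ρ⊆σ (after w)            = s⊆s (ρ⊆σ w)

  size : ∀ {σ ρ} → Word μ r ps gs ys σ ρ →
         ∣ σ ∣ + (length gs + length (full μ ys)) ≡ r + sum ps
  size (end free)          = refl
  size (end tail)          = refl
  size (block free w)      = size w
  size (block tail w)      = size w
  size (letter _ skip w)   = cong suc (size w)
  size (letter _ tick w)   = cong suc (size w)
  size (letter _ mark w)   = trans (+-suc _ _) (cong suc (size w))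
  size {gs = gs} {ys = ys} (last {σ = σ} w) =
    trans (cong (∣ σ ∣ +_) (+-suc (length gs) (length ys))) (trans (+-suc ∣ σ ∣ _) (cong suc (size w)))
  size (after w)           = cong suc (size w)

  -- Counts the restriction vertices still to be read in the current block that neither `gs` nor
  -- `ys` records.
  debt : Mode → ℕ → ℕ
  debt free     r = 0
  debt tail     r = r
  debt (pend y) r = y

  debt-Closed : Closed μ → debt μ 0 ≡ 0
  debt-Closed free = refl
  debt-Closed tail = refl

  debt-Open : Open μ → debt μ (suc r) ≡ debt μ r
  debt-Open free = refl
  debt-Open pend = refl

  restriction-size : ∀ {σ ρ} → Word μ r ps gs ys σ ρ → ∣ ρ ∣ ≡ debt μ r + (ΣL gs + ΣL ys)
  restriction-size (end k) rewrite debt-Closed k = refl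
  restriction-size {gs = gs} {ys = y ∷ ys} (block k w) rewrite debt-Closed k =
    trans (restriction-size w) (trans (sym (+-assoc y _ _)) (trans (cong (_+ ΣL ys) (+-comm y _)) (+-assoc (ΣL gs) y _)))
  restriction-size (letter {r = r} o skip w) rewrite debt-Open {r = r} o = restriction-size w
  restriction-size (letter {r = r} o tick w) rewrite debt-Open {r = r} o =
    trans (cong suc (restriction-size w)) (sym (+-suc _ _))
  restriction-size (letter {r = r} o mark w) rewrite debt-Open {r = r} o = restriction-size w
  restriction-size (last w)  = restriction-size w
  restriction-size (after w) = cong suc (restriction-size w)

  pend-misses : ∀ {σ ρ} → Word (pend y) r ps gs ys σ ρ → ¬ (replicate r inside ++ replicate (sum ps) outside) ⊆ σ
  pend-misses (end ())
  pend-misses (block () _)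
  pend-misses (letter _ _ w) q = pend-misses w (drop-∷-⊆ q)
  pend-misses (last w) q with q here
  ... | ()

  -- Only blocks still to be entered are covered, the `r` current vertices taking the place of `V'`
  -- in `ΛFace`. A block is handled by `pend-misses` on entry.
  word-misses : ∀ {σ ρ} → Word μ r ps gs ys σ ρ → ΛFace r ps σ
  word-misses (block _ w) zero    q = pend-misses w q
  word-misses (block _ w) (suc i) q = word-misses w i q
  word-misses (letter _ _ w) i q = word-misses w i (drop-∷-⊆ q)
  word-misses (last w) i q = word-misses w i (drop-∷-⊆ q)
  word-misses (after w) i q = word-misses w i (drop-∷-⊆ q)

  -- Existence of words with prescribed exponents

  data Fits : Vec ℕ m → List ℕ → Set where
    []  : Fits [] []
    _∷_ : y < p → Fits ps ys → Fits (p ∷ ps) (y ∷ ys)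

  -- The number of vertices that the entries occupy: each gap with its mark, or each final run with
  -- the complement vertex in front of it.
  need : List ℕ → ℕ
  need gs = ΣL (List.map suc gs)

  fits-need : Fits ps ys → need ys ≤ sum ps
  fits-need []       = z≤n
  fits-need (l ∷ fs) = +-mono-≤ l (fits-need fs)

  choose : ∀ {e N S} gs → need gs + N ≤ suc e + S → N ≤ S →
           ∃₂ λ b c → ∃ λ gs' → Step b c gs gs' × need gs' + N ≤ e + S
  choose {e} []     l k     = _ , _ , _ , skip , m≤n⇒m≤o+n e k
  choose (zero ∷ gs) (s≤s l) k  = _ , _ , _ , mark , l
  choose (suc g ∷ gs) (s≤s l) k = _ , _ , _ , tick , l

  -- The word is built greedily from left to right. The entries of `ys` fix the last complement
  -- vertices, `e` counts the vertices in front of the current one, and elsewhere the gaps are used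
  -- up as early as possible. The inequality says that the remaining entries fit; the final run of
  -- the current block is already accounted for and does not enter it.
  word-next : Closed μ → (ps : Vec ℕ m) → Fits ps ys → need gs + need ys ≤ sum ps → ∃₂ (Word μ 0 ps gs ys)
  word-pend : ∀ e → Fits ps ys → need gs + need ys ≤ e + sum ps → ∃₂ (Word (pend y) (e + suc y) ps gs ys)
  word-tail : ∀ r → Fits ps ys → need gs + need ys ≤ sum ps → ∃₂ (Word tail r ps gs ys)
  word-free : ∀ r → Fits ps ys → need gs + need ys ≤ r + sum ps → ∃₂ (Word free r ps gs ys)

  word-next {gs = []} k [] [] l = _ , _ , end k
  word-next {ys = y ∷ ys} {gs = gs} k (p ∷ ps) (y<p ∷ fs) l =
    let _ , _ , w = subst (λ p → ∃₂ (Word (pend y) p ps gs ys)) p≡ (word-pend (p ∸ suc y) fs l')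
    in _ , _ , block k w
    where
    p≡ : p ∸ suc y + suc y ≡ p
    p≡ = m∸n+n≡m y<p
    l' : need gs + need ys ≤ p ∸ suc y + sum ps
    l' = +-cancelˡ-≤ (suc y) _ _ (begin
      suc y + (need gs + need ys)       ≡⟨ sym (+-assoc (suc y) (need gs) _) ⟩
      suc y + need gs + need ys         ≡⟨ cong (_+ need ys) (+-comm (suc y) (need gs)) ⟩
      need gs + suc y + need ys         ≡⟨ +-assoc (need gs) (suc y) _ ⟩
      need gs + need (y ∷ ys)           ≤⟨ l ⟩
      p + sum ps                        ≡⟨ cong (_+ sum ps) (trans (sym p≡) (+-comm _ (suc y))) ⟩
      suc y + (p ∸ suc y) + sum ps      ≡⟨ +-assoc (suc y) _ _ ⟩
      suc y + (p ∸ suc y + sum ps)      ∎)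
      where open ≤-Reasoning

  word-pend zero    fs l = let _ , _ , w = word-tail _ fs l in _ , _ , last w
  word-pend (suc e) fs l =
    let _ , _ , _ , s , l' = choose _ l (fits-need fs)
        _ , _ , w = word-pend e fs l'
    in _ , _ , letter pend s w

  word-tail zero    fs l = word-next tail _ fs l
  word-tail (suc r) fs l = let _ , _ , w = word-tail r fs l in _ , _ , after w

  word-free zero    fs l = word-next free _ fs l
  word-free (suc r) fs l =
    let _ , _ , _ , s , l' = choose _ l (fits-need fs)
        _ , _ , w = word-free r fs l'
    in _ , _ , letter free s w

-- The h-vector of a complex partitioned into intervals

module HVectors where

  open import Data.Nat as ℕ using (ℕ; zero; suc; _∸_; _≤_; s≤s)
  import Data.Nat.Properties as ℕ
  open import Data.Integer using (ℤ; +_; -[1+_]; _+_; _*_; -_; _-_)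
  open import Data.Integer.Properties
  open import Data.Bool using (Bool; true; false; if_then_else_)
  open import Data.Fin.Subset using (Subset; inside; outside; _⊆_; ∣_∣)
  open import Data.Fin.Subset.Properties using (_⊆?_; drop-∷-⊆; p⊆q⇒∣p∣≤∣q∣)
  open import Data.Vec using ([]; _∷_; here; there)
  open import Data.List using (List; []; _∷_; length; filter; map; foldr; upTo; _++_)
  open import Data.List.Membership.Propositional.Properties using (∈-upTo⁺)
  open import Data.List.Relation.Unary.Any as Any using (Any; here; there)
  open import Data.List.Relation.Unary.All using (All; []; _∷_)
  open import Data.List.Relation.Unary.AllPairs as AllPairs using (AllPairs; []; _∷_)
  open import Data.List.Relation.Unary.Unique.Propositional.Properties using (upTo⁺)
  open import Data.Product using (_×_; _,_)
  open import Function using (id; _∘_; _⇔_; Equivalence)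
  open import Relation.Binary.PropositionalEquality
  open import Relation.Nullary using (¬_; Dec; yes; no; does; contradiction)
  open import Relation.Nullary.Decidable using (_×-dec_; dec-true; dec-false)
  open import Level using (0ℓ)
  open import Relation.Unary using (Pred; Decidable)
  open import Algebra.Properties.CommutativeSemigroup +-commutativeSemigroup using (interchange)

  0ℤ 1ℤ : ℤ
  0ℤ = + 0
  1ℤ = + 1

  ∑ : {A : Set} → List A → (A → ℤ) → ℤ
  ∑ []       f = 0ℤ
  ∑ (x ∷ xs) f = f x + ∑ xs f

  coeff-⊕ : ∀ p q k → coeff (p ⊕ q) k ≡ coeff p k + coeff q k
  coeff-⊕ []      q       k       = sym (+-identityˡ _)
  coeff-⊕ (a ∷ p) []      k       = sym (+-identityʳ _)
  coeff-⊕ (a ∷ p) (b ∷ q) zero    = refl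
  coeff-⊕ (a ∷ p) (b ∷ q) (suc k) = coeff-⊕ p q k

  coeff-scale : ∀ c p k → coeff (scale c p) k ≡ c * coeff p k
  coeff-scale c []      k       = sym (*-zeroʳ c)
  coeff-scale c (a ∷ p) zero    = refl
  coeff-scale c (a ∷ p) (suc k) = coeff-scale c p k

  infix 4 _≗ₚ_
  -- Coefficient lists may end in zeros, so polynomials are compared coefficientwise.
  _≗ₚ_ : Poly → Poly → Set
  p ≗ₚ q = ∀ k → coeff p k ≡ coeff q k

  delay : (ℕ → ℤ) → ℕ → ℤ
  delay f zero    = 0ℤ
  delay f (suc k) = f k

  coeff-0∷ : ∀ p k → coeff (0ℤ ∷ p) k ≡ delay (coeff p) k
  coeff-0∷ p zero    = refl
  coeff-0∷ p (suc k) = refl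

  coeff-∷-⊗ : ∀ a p q k → coeff ((a ∷ p) ⊗ q) k ≡ a * coeff q k + delay (coeff (p ⊗ q)) k
  coeff-∷-⊗ a p q k = trans (coeff-⊕ (scale a q) _ k) (cong₂ _+_ (coeff-scale a q k) (coeff-0∷ (p ⊗ q) k))

  delay-cong : ∀ {f g} → f ≗ g → delay f ≗ delay g
  delay-cong e zero    = refl
  delay-cong e (suc k) = e k

  delay-[] : ∀ k → delay (coeff []) k ≡ 0ℤ
  delay-[] zero    = refl
  delay-[] (suc k) = refl

  ⊗-zero : ∀ p q → p ≗ₚ [] → p ⊗ q ≗ₚ []
  ⊗-zero []      q e k = refl
  ⊗-zero (a ∷ p) q e k = begin
    coeff ((a ∷ p) ⊗ q) k                     ≡⟨ coeff-∷-⊗ a p q k ⟩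
    a * coeff q k + delay (coeff (p ⊗ q)) k
      ≡⟨ cong₂ (λ a b → a * coeff q k + b) (e 0) (trans (delay-cong (⊗-zero p q (e ∘ suc)) k) (delay-[] k)) ⟩
    0ℤ * coeff q k + 0ℤ                       ≡⟨ cong (_+ 0ℤ) (*-zeroˡ (coeff q k)) ⟩
    0ℤ                                        ∎
    where
    open ≡-Reasoning

  ⊗-congˡ : ∀ p p' q → p ≗ₚ p' → p ⊗ q ≗ₚ p' ⊗ q
  ⊗-congˡ []      p'        q e k = sym (⊗-zero p' q (sym ∘ e) k)
  ⊗-congˡ (a ∷ p) []        q e k = ⊗-zero (a ∷ p) q e k
  ⊗-congˡ (a ∷ p) (a' ∷ p') q e k = trans (coeff-∷-⊗ a p q k) (trans
    (cong₂ (λ a b → a * coeff q k + b) (e 0) (delay-cong (⊗-congˡ p p' q (e ∘ suc)) k))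
    (sym (coeff-∷-⊗ a' p' q k)))

  1⊗ : ∀ q → coeff (pow X 0 ⊗ q) ≗ coeff q
  1⊗ q k = trans (coeff-∷-⊗ 1ℤ [] q k) (trans (cong₂ _+_ (*-identityˡ (coeff q k)) (delay-[] k)) (+-identityʳ _))

  coeff-X⊗ : ∀ p k → coeff (X ⊗ p) k ≡ delay (coeff p) k
  coeff-X⊗ p k = begin
    coeff (X ⊗ p) k                                   ≡⟨ coeff-∷-⊗ 0ℤ (1ℤ ∷ []) p k ⟩
    0ℤ * coeff p k + delay (coeff ((1ℤ ∷ []) ⊗ p)) k  ≡⟨ cong₂ _+_ (*-zeroˡ (coeff p k)) (delay-cong (1⊗ p) k) ⟩
    0ℤ + delay (coeff p) k                            ≡⟨ +-identityˡ _ ⟩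
    delay (coeff p) k                                 ∎
    where
    open ≡-Reasoning

  cf : ℕ → ℕ → ℕ → ℤ
  cf i j = coeff (pow X i ⊗ pow oneMinusX j)

  pow-X-⊗ : ∀ i q → coeff (pow X (suc i) ⊗ q) ≗ delay (coeff (pow X i ⊗ q))
  pow-X-⊗ i q k = begin
    coeff (pow X (suc i) ⊗ q) k
      ≡⟨ ⊗-congˡ (pow X (suc i)) (0ℤ ∷ pow X i) q (λ k → trans (coeff-X⊗ (pow X i) k) (sym (coeff-0∷ (pow X i) k))) k ⟩
    coeff ((0ℤ ∷ pow X i) ⊗ q) k                      ≡⟨ coeff-∷-⊗ 0ℤ (pow X i) q k ⟩
    0ℤ * coeff q k + delay (coeff (pow X i ⊗ q)) k
      ≡⟨ cong (_+ delay (coeff (pow X i ⊗ q)) k) (*-zeroˡ (coeff q k)) ⟩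
    0ℤ + delay (coeff (pow X i ⊗ q)) k                ≡⟨ +-identityˡ _ ⟩
    delay (coeff (pow X i ⊗ q)) k                     ∎
    where open ≡-Reasoning

  coeff-oneMinusX⊗ : ∀ q k → coeff (oneMinusX ⊗ q) k + delay (coeff q) k ≡ coeff q k
  coeff-oneMinusX⊗ q k = begin
    coeff (oneMinusX ⊗ q) k + delay (coeff q) k
      ≡⟨ cong (_+ delay (coeff q) k) (coeff-∷-⊗ 1ℤ (-[1+ 0 ] ∷ []) q k) ⟩
    1ℤ * coeff q k + delay (coeff ((-[1+ 0 ] ∷ []) ⊗ q)) k + delay (coeff q) k ≡⟨ +-assoc (1ℤ * coeff q k) _ _ ⟩
    1ℤ * coeff q k + (delay (coeff ((-[1+ 0 ] ∷ []) ⊗ q)) k + delay (coeff q) k)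
      ≡⟨ cong₂ _+_ (*-identityˡ (coeff q k)) (cancel k) ⟩
    coeff q k + 0ℤ ≡⟨ +-identityʳ _ ⟩
    coeff q k ∎
    where
    open ≡-Reasoning
    cancel : ∀ k → delay (coeff ((-[1+ 0 ] ∷ []) ⊗ q)) k + delay (coeff q) k ≡ 0ℤ
    cancel zero    = refl
    cancel (suc k) = trans (cong (_+ coeff q k) (trans (coeff-∷-⊗ -[1+ 0 ] [] q k)
                       (trans (cong₂ _+_ (-1*i≡-i (coeff q k)) (delay-[] k)) (+-identityʳ (- coeff q k)))))
                     (+-inverseˡ (coeff q k))

  cf-split : ∀ i j k → cf i (suc j) k + cf (suc i) j k ≡ cf i j k
  cf-split zero    j k = trans (cong₂ _+_ (1⊗ (pow oneMinusX (suc j)) k)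
      (trans (pow-X-⊗ 0 q k) (delay-cong (1⊗ q) k)))
    (trans (coeff-oneMinusX⊗ q k) (sym (1⊗ q k)))
    where q = pow oneMinusX j
  cf-split (suc i) j k = trans (cong₂ _+_ (pow-X-⊗ i _ k) (pow-X-⊗ (suc i) _ k)) (trans (go k) (sym (pow-X-⊗ i _ k)))
    where
    go : ∀ k → delay (cf i (suc j)) k + delay (cf (suc i) j) k ≡ delay (cf i j) k
    go zero    = refl
    go (suc k) = cf-split i j k

  δ : ℕ → ℕ → ℤ
  δ i k = if does (i ℕ.≟ k) then 1ℤ else 0ℤ

  cf-0 : ∀ i k → cf i 0 k ≡ δ i k
  cf-0 zero    zero          = refl
  cf-0 zero    (suc zero)    = refl
  cf-0 zero    (suc (suc k)) = refl
  cf-0 (suc i) zero          = pow-X-⊗ i _ 0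
  cf-0 (suc i) (suc k)       = trans (pow-X-⊗ i _ (suc k)) (cf-0 i k)

  private variable
    A B : Set

  ∑-cong : ∀ (xs : List A) {f g : A → ℤ} → (∀ x → f x ≡ g x) → ∑ xs f ≡ ∑ xs g
  ∑-cong []       e = refl
  ∑-cong (x ∷ xs) e = cong₂ _+_ (e x) (∑-cong xs e)

  ∑-0 : ∀ (xs : List A) → ∑ xs (λ _ → 0ℤ) ≡ 0ℤ
  ∑-0 []       = refl
  ∑-0 (x ∷ xs) = trans (+-identityˡ _) (∑-0 xs)

  ∑-+ : ∀ (xs : List A) (f g : A → ℤ) → ∑ xs (λ x → f x + g x) ≡ ∑ xs f + ∑ xs g
  ∑-+ []       f g = refl
  ∑-+ (x ∷ xs) f g = trans (cong (_+_ (f x + g x)) (∑-+ xs f g)) (interchange (f x) (g x) _ _)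

  ∑-swap : ∀ (xs : List A) (ys : List B) (f : A → B → ℤ) →
           ∑ xs (λ x → ∑ ys (f x)) ≡ ∑ ys (λ y → ∑ xs (λ x → f x y))
  ∑-swap []       ys f = sym (∑-0 ys)
  ∑-swap (x ∷ xs) ys f = trans (cong (_+_ (∑ ys (f x))) (∑-swap xs ys f)) (sym (∑-+ ys (f x) _))

  ∑-++ : ∀ (xs ys : List A) (f : A → ℤ) → ∑ (xs ++ ys) f ≡ ∑ xs f + ∑ ys f
  ∑-++ []       ys f = sym (+-identityˡ _)
  ∑-++ (x ∷ xs) ys f = trans (cong (_+_ (f x)) (∑-++ xs ys f)) (sym (+-assoc (f x) _ _))

  ∑-map : ∀ (xs : List A) (h : A → B) (f : B → ℤ) → ∑ (map h xs) f ≡ ∑ xs (f ∘ h)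
  ∑-map []       h f = refl
  ∑-map (x ∷ xs) h f = cong (_+_ (f (h x))) (∑-map xs h f)

  when : Bool → ℤ → ℤ
  when b z = if b then z else 0ℤ

  length-filter : ∀ {P : Pred A 0ℓ} (P? : Decidable P) (xs : List A) z →
                  + length (filter P? xs) * z ≡ ∑ xs (λ x → when (does (P? x)) z)
  length-filter P? []       z = *-zeroˡ z
  length-filter P? (x ∷ xs) z with does (P? x)
  ... | false = trans (length-filter P? xs z) (sym (+-identityˡ _))
  ... | true  = trans (suc-* (+ length (filter P? xs)) z) (cong (_+_ z) (length-filter P? xs z))

  ∑-filter : ∀ {P : Pred A 0ℓ} (P? : Decidable P) (xs : List A) (f : A → ℤ) →
             ∑ (filter P? xs) f ≡ ∑ xs (λ x → when (does (P? x)) (f x))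
  ∑-filter P? []       f = refl
  ∑-filter P? (x ∷ xs) f with does (P? x)
  ... | false = trans (∑-filter P? xs f) (sym (+-identityˡ _))
  ... | true  = cong (_+_ (f x)) (∑-filter P? xs f)

  ∑-none : ∀ {P : Pred A 0ℓ} (P? : Decidable P) (xs : List A) (f : A → ℤ) → ¬ Any P xs →
           ∑ xs (λ x → when (does (P? x)) (f x)) ≡ 0ℤ
  ∑-none P? []       f n = refl
  ∑-none P? (x ∷ xs) f n with P? x
  ... | yes p = contradiction (here p) n
  ... | no _  = trans (+-identityˡ _) (∑-none P? xs f (n ∘ there))

  ∑-one : ∀ {P : Pred A 0ℓ} (P? : Decidable P) (xs : List A) z →
          AllPairs (λ x y → ¬ (P x × P y)) xs → Any P xs →
          ∑ xs (λ x → when (does (P? x)) z) ≡ z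
  ∑-one P? (x ∷ xs) z (ns ∷ as) p with P? x | p
  ... | yes px | _        = trans (cong (_+_ z) (∑-none P? xs (λ _ → z) (λ q → none ns q))) (+-identityʳ z)
    where
    none : ∀ {xs} → All (λ y → ¬ (_ × _)) xs → ¬ Any _ xs
    none (n ∷ ns) (here q)  = n (px , q)
    none (n ∷ ns) (there q) = none ns q
  ... | no ¬px | here px  = contradiction px ¬px
  ... | no ¬px | there q  = trans (+-identityˡ _) (∑-one P? xs z as q)

  Between : ∀ {n} → Subset n → Subset n → Subset n → Set
  Between ρ φ σ = ρ ⊆ σ × σ ⊆ φ

  between? : ∀ {n} (ρ φ σ : Subset n) → Dec (Between ρ φ σ)
  between? ρ φ σ = (ρ ⊆? σ) ×-dec (σ ⊆? φ)

  -- The recursive form lets `interval-sum` proceed vertex by vertex without truncated subtraction.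
  gap : ∀ {n} → Subset n → Subset n → ℕ
  gap []            []            = 0
  gap (inside ∷ φ)  (outside ∷ σ) = suc (gap φ σ)
  gap (outside ∷ φ) (_ ∷ σ)       = gap φ σ
  gap (inside ∷ φ)  (inside ∷ σ)  = gap φ σ

  gap-∸ : ∀ {n} (φ σ : Subset n) → σ ⊆ φ → gap φ σ ≡ ∣ φ ∣ ∸ ∣ σ ∣
  gap-∸ []            []            q = refl
  gap-∸ (outside ∷ φ) (outside ∷ σ) q = gap-∸ φ σ (drop-∷-⊆ q)
  gap-∸ (outside ∷ φ) (inside ∷ σ)  q with q here
  ... | ()
  gap-∸ (inside ∷ φ)  (inside ∷ σ)  q = gap-∸ φ σ (drop-∷-⊆ q)
  gap-∸ (inside ∷ φ)  (outside ∷ σ) q =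
    trans (cong suc (gap-∸ φ σ (drop-∷-⊆ q))) (sym (ℕ.+-∸-assoc 1 (p⊆q⇒∣p∣≤∣q∣ (drop-∷-⊆ q))))

  -- `a` and `b` accumulate the exponents of X and 1 - X contributed by the vertices already read.
  interval-term : ∀ {n} → ℕ → Subset n → Subset n → ℕ → ℕ → Subset n → ℤ
  interval-term k ρ φ a b σ = when (does (between? ρ φ σ)) (cf (a ℕ.+ ∣ σ ∣) (b ℕ.+ gap φ σ) k)

  when-no : ∀ {P : Set} (P? : Dec P) {z} → ¬ P → when (does P?) z ≡ 0ℤ
  when-no P? n rewrite dec-false P? n = refl

  when-yes : ∀ {P : Set} (P? : Dec P) {z} → P → when (does P?) z ≡ z
  when-yes P? p rewrite dec-true P? p = refl

  if-yes : ∀ {P : Set} (P? : Dec P) {z z'} → (P → z ≡ z') → when (does P?) z ≡ when (does P?) z'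
  if-yes (yes p) e = e p
  if-yes (no _)  e = refl

  ∑-subsets : ∀ n (f : Subset (suc n) → ℤ) → ∑ (allSubsets (suc n)) f ≡
              ∑ (allSubsets n) (f ∘ (outside ∷_)) + ∑ (allSubsets n) (f ∘ (inside ∷_))
  ∑-subsets n f = trans (∑-++ (map (outside ∷_) (allSubsets n)) _ f)
                        (cong₂ _+_ (∑-map (allSubsets n) _ f) (∑-map (allSubsets n) _ f))

  -- Each free vertex of the interval contributes (1 - X) + X = 1.
  interval-sum : ∀ {n} k (ρ φ : Subset n) → ρ ⊆ φ → ∀ a b →
                 ∑ (allSubsets n) (interval-term k ρ φ a b) ≡ cf (a ℕ.+ ∣ ρ ∣) b k
  interval-sum k [] [] q a b =
    trans (+-identityʳ _) (trans (when-yes (between? [] [] []) (id , id)) (cong (λ j → cf (a ℕ.+ 0) j k) (ℕ.+-identityʳ b)))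
  interval-sum {suc n} k (inside ∷ ρ) (outside ∷ φ) q a b with q here
  ... | ()
  interval-sum {suc n} k (outside ∷ ρ) (outside ∷ φ) q a b = begin
    ∑ (allSubsets (suc n)) f                                          ≡⟨ ∑-subsets n f ⟩
    ∑ (allSubsets n) (f ∘ (outside ∷_)) + ∑ (allSubsets n) (f ∘ (inside ∷_)) ≡⟨ cong (_+_ (∑ (allSubsets n) (interval-term k ρ φ a b)))
         (trans (∑-cong (allSubsets n) λ σ →
                   when-no (between? (outside ∷ ρ) (outside ∷ φ) (inside ∷ σ)) λ (_ , s) →
                     contradiction (s here) λ ())
                (∑-0 (allSubsets n))) ⟩
    ∑ (allSubsets n) (interval-term k ρ φ a b) + 0ℤ                   ≡⟨ +-identityʳ _ ⟩
    ∑ (allSubsets n) (interval-term k ρ φ a b)                        ≡⟨ interval-sum k ρ φ (drop-∷-⊆ q) a b ⟩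
    cf (a ℕ.+ ∣ ρ ∣) b k                                              ∎
    where
    open ≡-Reasoning
    f = interval-term k (outside ∷ ρ) (outside ∷ φ) a b
  interval-sum {suc n} k (inside ∷ ρ) (inside ∷ φ) q a b = begin
    ∑ (allSubsets (suc n)) f                                          ≡⟨ ∑-subsets n f ⟩
    ∑ (allSubsets n) (f ∘ (outside ∷_)) + ∑ (allSubsets n) (f ∘ (inside ∷_)) ≡⟨ cong₂ _+_ (∑-0 (allSubsets n))
         (∑-cong (allSubsets n) λ σ →
            cong (λ i → when (does (between? ρ φ σ)) (cf i (b ℕ.+ gap φ σ) k)) (ℕ.+-suc a ∣ σ ∣)) ⟩
    0ℤ + ∑ (allSubsets n) (interval-term k ρ φ (suc a) b)             ≡⟨ +-identityˡ _ ⟩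
    ∑ (allSubsets n) (interval-term k ρ φ (suc a) b)
      ≡⟨ interval-sum k ρ φ (drop-∷-⊆ q) (suc a) b ⟩
    cf (suc a ℕ.+ ∣ ρ ∣) b k
      ≡⟨ cong (λ i → cf i b k) (sym (ℕ.+-suc a ∣ ρ ∣)) ⟩
    cf (a ℕ.+ suc ∣ ρ ∣) b k                                          ∎
    where
    open ≡-Reasoning
    f = interval-term k (inside ∷ ρ) (inside ∷ φ) a b
  interval-sum {suc n} k (outside ∷ ρ) (inside ∷ φ) q a b = begin
    ∑ (allSubsets (suc n)) f                                          ≡⟨ ∑-subsets n f ⟩
    ∑ (allSubsets n) (f ∘ (outside ∷_)) + ∑ (allSubsets n) (f ∘ (inside ∷_)) ≡⟨ cong₂ _+_
       (∑-cong (allSubsets n) λ σ →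
            cong (λ j → when (does (between? ρ φ σ)) (cf (a ℕ.+ ∣ σ ∣) j k)) (ℕ.+-suc b (gap φ σ)))
       (∑-cong (allSubsets n) λ σ →
            cong (λ i → when (does (between? ρ φ σ)) (cf i (b ℕ.+ gap φ σ) k)) (ℕ.+-suc a ∣ σ ∣)) ⟩
    ∑ (allSubsets n) (interval-term k ρ φ a (suc b)) + ∑ (allSubsets n) (interval-term k ρ φ (suc a) b)
       ≡⟨ cong₂ _+_ (interval-sum k ρ φ (drop-∷-⊆ q) a (suc b)) (interval-sum k ρ φ (drop-∷-⊆ q) (suc a) b) ⟩
    cf (a ℕ.+ ∣ ρ ∣) (suc b) k + cf (suc a ℕ.+ ∣ ρ ∣) b k             ≡⟨ cf-split (a ℕ.+ ∣ ρ ∣) b k ⟩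
    cf (a ℕ.+ ∣ ρ ∣) b k                                              ∎
    where
    open ≡-Reasoning
    f = interval-term k (outside ∷ ρ) (inside ∷ φ) a b

  coeff-foldr : ∀ {A : Set} (xs : List A) (f : A → Poly) k →
                coeff (foldr _⊕_ [] (map f xs)) k ≡ ∑ xs (λ x → coeff (f x) k)
  coeff-foldr []       f k = refl
  coeff-foldr (x ∷ xs) f k = trans (coeff-⊕ (f x) _ k) (cong (_+_ (coeff (f x) k)) (coeff-foldr xs f k))

  -- A face with s vertices contributes X^s (1 - X)^(d - s). Grouped by cells instead of by size,
  -- these terms add up to X^(size of `ρ a`) on each interval; no factor 1 - X survives because
  -- `φ a` has exactly `d` vertices.
  hVec-partition : ∀ {n d} (Γ : SimplicialComplex n) {A : Set} (ρ φ : A → Subset n) →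
    (∀ a → ρ a ⊆ φ a) → (∀ a → ∣ φ a ∣ ≡ d) → (cs : List A) →
    (∀ σ → AllPairs (λ a b → ¬ (Between (ρ a) (φ a) σ × Between (ρ b) (φ b) σ)) cs) →
    (∀ σ → IsFace Γ σ ⇔ Any (λ a → Between (ρ a) (φ a) σ) cs) →
    ∀ k → hVec d Γ k ≡ + length (filter (λ a → ∣ ρ a ∣ ℕ.≟ k) cs)
  hVec-partition {n} {d} Γ ρ φ ρ⊆φ ∣φ∣ cs disj cover k = begin
    hVec d Γ k
      ≡⟨ coeff-foldr (upTo (suc d)) term k ⟩
    ∑ (upTo (suc d)) (λ i → coeff (term i) k)
      ≡⟨ ∑-cong (upTo (suc d)) (λ i → trans (coeff-scale (+ faceCount Γ i) (pow X i ⊗ pow oneMinusX (d ∸ i)) k) (faces i)) ⟩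
    ∑ (upTo (suc d)) (λ i → ∑ (allSubsets n) (λ σ → when (does (∣ σ ∣ ℕ.≟ i)) (when (does (face? σ)) (c i))))
      ≡⟨ ∑-swap (upTo (suc d)) (allSubsets n) _ ⟩
    ∑ (allSubsets n) (λ σ → ∑ (upTo (suc d)) (λ i → when (does (∣ σ ∣ ℕ.≟ i)) (when (does (face? σ)) (c i))))
      ≡⟨ ∑-cong (allSubsets n) (λ σ → trans (by-size σ) (by-cell σ)) ⟩
    ∑ (allSubsets n) (λ σ → ∑ cs (λ a → when (does (between? (ρ a) (φ a) σ)) (c ∣ σ ∣)))
      ≡⟨ ∑-swap (allSubsets n) cs _ ⟩
    ∑ cs (λ a → ∑ (allSubsets n) (λ σ → when (does (between? (ρ a) (φ a) σ)) (c ∣ σ ∣)))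
      ≡⟨ ∑-cong cs (λ a → trans (∑-cong (allSubsets n) (codim a))
                       (trans (interval-sum k (ρ a) (φ a) (ρ⊆φ a) 0 0) (cf-0 ∣ ρ a ∣ k))) ⟩
    ∑ cs (λ a → δ ∣ ρ a ∣ k)
      ≡⟨ sym (length-filter (λ a → ∣ ρ a ∣ ℕ.≟ k) cs 1ℤ) ⟩
    + length (filter (λ a → ∣ ρ a ∣ ℕ.≟ k) cs) * 1ℤ
      ≡⟨ *-identityʳ _ ⟩
    + length (filter (λ a → ∣ ρ a ∣ ℕ.≟ k) cs) ∎
    where
    open ≡-Reasoning
    c : ℕ → ℤ
    c i = cf i (d ∸ i) k
    term : ℕ → Poly
    term i = scale (+ faceCount Γ i) (pow X i ⊗ pow oneMinusX (d ∸ i))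
    face? : ∀ σ → Dec (face Γ σ ≡ true)
    face? σ = face Γ σ Data.Bool.≟ true
    faces : ∀ i → + faceCount Γ i * c i ≡ ∑ (allSubsets n) (λ σ → when (does (∣ σ ∣ ℕ.≟ i)) (when (does (face? σ)) (c i)))
    faces i = trans (length-filter face? (filter (λ σ → ∣ σ ∣ ℕ.≟ i) (allSubsets n)) (c i))
                    (∑-filter (λ σ → ∣ σ ∣ ℕ.≟ i) (allSubsets n) _)
    bound : ∀ σ → face Γ σ ≡ true → ∣ σ ∣ ≤ d
    bound σ e with Any.satisfied (Equivalence.to (cover σ) e)
    ... | a , _ , q = subst (∣ σ ∣ ≤_) (∣φ∣ a) (p⊆q⇒∣p∣≤∣q∣ q)
    by-size : ∀ σ →
      ∑ (upTo (suc d)) (λ i → when (does (∣ σ ∣ ℕ.≟ i)) (when (does (face? σ)) (c i))) ≡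
      when (does (face? σ)) (c ∣ σ ∣)
    by-size σ with face? σ
    ... | no _  = trans (∑-cong (upTo (suc d)) (λ i → when-0 (does (∣ σ ∣ ℕ.≟ i)))) (∑-0 (upTo (suc d)))
      where
      when-0 : ∀ b → when b 0ℤ ≡ 0ℤ
      when-0 true  = refl
      when-0 false = refl
    -- By `bound` the size of a face is at most `d`, so exactly one index of the sum equals it.
    ... | yes e = trans (∑-cong (upTo (suc d)) same)
                        (∑-one (λ i → ∣ σ ∣ ℕ.≟ i) (upTo (suc d)) (c ∣ σ ∣)
                          (AllPairs.map (λ { n (refl , refl) → n refl }) (upTo⁺ (suc d))) (∈-upTo⁺ (s≤s (bound σ e))))
      where
      same : ∀ i → when (does (∣ σ ∣ ℕ.≟ i)) (c i) ≡ when (does (∣ σ ∣ ℕ.≟ i)) (c ∣ σ ∣)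
      same i = if-yes (∣ σ ∣ ℕ.≟ i) λ e → cong c (sym e)
    by-cell : ∀ σ → when (does (face? σ)) (c ∣ σ ∣) ≡ ∑ cs (λ a → when (does (between? (ρ a) (φ a) σ)) (c ∣ σ ∣))
    by-cell σ with face? σ
    ... | no ¬e = sym (∑-none (λ a → between? (ρ a) (φ a) σ) cs (λ _ → c ∣ σ ∣) (¬e ∘ Equivalence.from (cover σ)))
    ... | yes e = sym (∑-one (λ a → between? (ρ a) (φ a) σ) cs (c ∣ σ ∣) (disj σ) (Equivalence.to (cover σ) e))
    codim : ∀ a σ → when (does (between? (ρ a) (φ a) σ)) (c ∣ σ ∣) ≡ interval-term k (ρ a) (φ a) 0 0 σ
    codim a σ = if-yes (between? (ρ a) (φ a) σ) λ (_ , q) →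
      cong (λ j → cf ∣ σ ∣ j k) (trans (cong (_∸ ∣ σ ∣) (sym (∣φ∣ a))) (sym (gap-∸ (φ a) σ q)))

-- Shellings from facets with restrictions

module Shellings where

  open HVectors
  open Words using (_⊆[_]_)
  import Data.Integer
  open import Data.Nat as ℕ using (ℕ; zero; suc; _∸_; _≤_; s≤s; z≤n; s≤s⁻¹)
  import Data.Nat.Properties as ℕ
  open import Data.Bool using (true)
  open import Data.Fin using (Fin; zero; suc; toℕ; _<_)
  open import Data.Fin.Subset using (Subset; inside; outside; _⊆_; ∣_∣; _∈_; _∉_; _-_) renaming (⊥ to ∅)
  open import Data.Fin.Subset.Properties
  open import Data.Vec using ([]; _∷_; here; there)
  open import Data.List as List using (List; []; _∷_; length; map; lookup)
  open import Data.List.Membership.Propositional using (find) renaming (_∈_ to _∈ₗ_)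
  open import Data.List.Membership.Propositional.Properties using (∈-map⁺; ∈-map⁻; ∈-lookup)
  open import Data.List.Relation.Unary.Any as Any using (Any; here; there; any?)
  import Data.List.Relation.Unary.Any.Properties as Any
  open import Data.List.Relation.Unary.All as All using (All; []; _∷_)
  open import Data.List.Relation.Unary.AllPairs as AllPairs using (AllPairs; []; _∷_)
  import Data.List.Relation.Unary.AllPairs.Properties as AllPairs
  open import Data.Product using (∃; _×_; _,_; proj₁)
  open import Function using (_∘_; _⇔_; mk⇔)
  open import Relation.Binary.PropositionalEquality
  open import Relation.Nullary using (¬_; Dec; yes; no; does; contradiction)
  open import Relation.Nullary.Decidable using (dec-true)

  does⁻ : ∀ {P : Set} (P? : Dec P) → does P? ≡ true → P
  does⁻ (yes p) _ = p

  ⊆-size-≡ : ∀ {n} (p q : Subset n) → p ⊆ q → ∣ p ∣ ≡ ∣ q ∣ → p ≡ q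
  ⊆-size-≡ []            []            s e = refl
  ⊆-size-≡ (outside ∷ p) (outside ∷ q) s e = cong (outside ∷_) (⊆-size-≡ p q (drop-∷-⊆ s) e)
  ⊆-size-≡ (inside ∷ p)  (inside ∷ q)  s e = cong (inside ∷_) (⊆-size-≡ p q (drop-∷-⊆ s) (ℕ.suc-injective e))
  ⊆-size-≡ (outside ∷ p) (inside ∷ q)  s e = contradiction (p⊆q⇒∣p∣≤∣q∣ (drop-∷-⊆ s)) (ℕ.<⇒≱ (ℕ.≤-reflexive (sym e)))
  ⊆-size-≡ (inside ∷ p)  (outside ∷ q) s e with s here
  ... | ()

  ⊈⇒∃ : ∀ {n} (p q : Subset n) → ¬ p ⊆ q → ∃ λ v → v ∈ p × v ∉ q
  ⊈⇒∃ []            q             n = contradiction (λ ()) n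
  ⊈⇒∃ (inside ∷ p)  (outside ∷ q) n = zero , here , λ ()
  ⊈⇒∃ (outside ∷ p) (s ∷ q)       n = let v , a , b = ⊈⇒∃ p q (λ i → n (out⊆ i)) in suc v , there a , λ { (there x) → b x }
  ⊈⇒∃ (inside ∷ p)  (inside ∷ q)  n = let v , a , b = ⊈⇒∃ p q (λ i → n (s⊆s i)) in suc v , there a , λ { (there x) → b x }

  ∣p-x∣ : ∀ {n} {p : Subset n} {x} → x ∈ p → ∣ p - x ∣ ≡ ∣ p ∣ ∸ 1
  ∣p-x∣ {p = inside ∷ p} here = cong ∣_∣ (p─⊥≡p p)
  ∣p-x∣ {p = outside ∷ p} (there e) = ∣p-x∣ e
  ∣p-x∣ {p = inside ∷ p} {suc x} (there e) = trans (cong suc (∣p-x∣ e)) (ℕ.m+[n∸m]≡n (nonempty e))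
    where
    nonempty : ∀ {n} {p : Subset n} {x} → x ∈ p → 1 ≤ ∣ p ∣
    nonempty here                          = s≤s z≤n
    nonempty {p = inside ∷ p} (there e)  = s≤s z≤n
    nonempty {p = outside ∷ p} (there e) = nonempty e

  x∈p-y⁻ : ∀ {n} (p : Subset n) {x y} → x ∈ p - y → x ∈ p × x ≢ y
  x∈p-y⁻ p {x} {y} e = p─q⊆p p _ e , λ { refl → x∉p-x p e }
    where
    x∉p-x : ∀ {n} (p : Subset n) {x} → x ∉ p - x
    x∉p-x (inside ∷ p) {zero} ()
    x∉p-x (outside ∷ p) {zero} ()
    x∉p-x (inside ∷ p) {suc x} (there e) = x∉p-x p e
    x∉p-x (outside ∷ p) {suc x} (there e) = x∉p-x p e

  AllPairs-lookup : ∀ {A : Set} {R : A → A → Set} {xs : List A} → AllPairs R xs →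
                    ∀ {i j} → i < j → R (lookup xs i) (lookup xs j)
  AllPairs-lookup {xs = x ∷ xs} (rs ∷ _) {zero}  {suc j} _ = All.lookup rs (∈-lookup j)
  AllPairs-lookup {xs = x ∷ xs} (_ ∷ rs) {suc i} {suc j} l = AllPairs-lookup rs (s≤s⁻¹ l)

  module _ {A B : Set} (f : A → B) where
    map-index : (xs : List A) (i : Fin (length (map f xs))) →
                ∃ λ j → toℕ j ≡ toℕ i × lookup (map f xs) i ≡ f (lookup xs j)
    map-index (x ∷ xs) zero    = zero , refl , refl
    map-index (x ∷ xs) (suc i) = let j , e , l = map-index xs i in suc j , cong suc e , l

    index-map : (xs : List A) (j : Fin (length xs)) →
                ∃ λ i → toℕ i ≡ toℕ j × lookup (map f xs) i ≡ f (lookup xs j)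
    index-map (x ∷ xs) zero    = zero , refl , refl
    index-map (x ∷ xs) (suc j) = let i , e , l = index-map xs j in suc i , cong suc e , l

  -- The hypotheses make `ρ` the restriction map of the order: by `step` a face of a facet that
  -- misses a vertex of its restriction lies in an earlier facet, and by `fresh` a face containing
  -- the restriction lies in none.
  module Shelling {n d : ℕ} {A : Set} (φ ρ : A → Subset n)
    (ρ⊆φ : ∀ a → ρ a ⊆ φ a) (∣φ∣ : ∀ a → ∣ φ a ∣ ≡ d)
    (a₀ : A) (as : List A)
    (fresh : AllPairs (λ a b → ¬ ρ b ⊆ φ a) (a₀ ∷ as))
    (step : ∀ i {v} → v ∈ ρ (lookup (a₀ ∷ as) i) →
            ∃ λ j → j < i × φ (lookup (a₀ ∷ as) i) ⊆[ v ] φ (lookup (a₀ ∷ as) j))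
    where

    cs : List A
    cs = a₀ ∷ as

    covered? : ∀ σ → Dec (Any (λ a → σ ⊆ φ a) cs)
    covered? σ = any? (λ a → σ ⊆? φ a) cs

    face⁻ : ∀ {σ} → does (covered? σ) ≡ true → Any (λ a → σ ⊆ φ a) cs
    face⁻ {σ} e = does⁻ (covered? σ) e

    face⁺ : ∀ {σ} → Any (λ a → σ ⊆ φ a) cs → does (covered? σ) ≡ true
    face⁺ {σ} p = dec-true (covered? σ) p

    complex : SimplicialComplex n
    complex = record
      { face       = λ σ → does (covered? σ)
      ; empty      = face⁺ (here ⊥⊆)
      ; downClosed = λ σ τ e τ⊆σ → face⁺ (Any.map (λ σ⊆ {x} x∈τ → σ⊆ (τ⊆σ x∈τ)) (face⁻ e))
      }

    facet : ∀ a → a ∈ₗ cs → IsFacet (IsFace complex) (φ a)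
    facet a a∈ = face⁺ (Any.map (λ { refl {_} x∈ → x∈ }) a∈) , λ τ e φ⊆τ → maximal τ φ⊆τ (Any.satisfied (face⁻ e))
      where
      maximal : ∀ τ → φ a ⊆ τ → ∃ (λ b → τ ⊆ φ b) → τ ≡ φ a
      maximal τ φ⊆τ (b , τ⊆) = ⊆-antisym (subst (τ ⊆_) (sym same) τ⊆) φ⊆τ
        where same = ⊆-size-≡ (φ a) (φ b) (τ⊆ ∘ φ⊆τ) (trans (∣φ∣ a) (sym (∣φ∣ b)))

    facet⁻ : ∀ σ → IsFacet (IsFace complex) σ → σ ∈ₗ map φ cs
    facet⁻ σ (e , maximal) with find (face⁻ e)
    ... | a , a∈ , σ⊆ = subst (_∈ₗ map φ cs) (maximal (φ a) (proj₁ (facet a a∈)) σ⊆) (∈-map⁺ φ a∈)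

    pure : PureDim d (IsFace complex)
    pure = ((λ σ e → let a , σ⊆ = Any.satisfied (face⁻ e) in subst (∣ σ ∣ ≤_) (∣φ∣ a) (p⊆q⇒∣p∣≤∣q∣ σ⊆)) ,
            φ a₀ , proj₁ (facet a₀ (here refl)) , ∣φ∣ a₀) ,
           λ σ f → let a , _ , e = ∈-map⁻ φ (facet⁻ σ f) in trans (cong ∣_∣ e) (∣φ∣ a)

    Inter : Fin (length cs) → Subset n → Set
    Inter i σ = σ ⊆ φ (lookup cs i) × ∃ λ j → j < i × σ ⊆ φ (lookup cs j)

    -- By `fresh`, some `v` in the restriction of facet `i` is missing from the earlier facet around
    -- `σ`, hence from `σ`. By `step`, removing `v` from facet `i` leaves a ridge inside an earlier
    -- facet, and this ridge contains `σ`.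
    ridge : ∀ i {σ} → Inter i σ → ∃ λ v → v ∈ φ (lookup cs i) × σ ⊆ φ (lookup cs i) - v × Inter i (φ (lookup cs i) - v)
    ridge i {σ} (σ⊆ , j , j<i , σ⊆') with ⊈⇒∃ (ρ (lookup cs i)) (φ (lookup cs j)) (AllPairs-lookup fresh j<i)
    ... | v , v∈ρ , v∉ with step i v∈ρ
    ... | j' , j'<i , q =
      v , ρ⊆φ _ v∈ρ ,
      (λ x∈σ → x∈p∧x≢y⇒x∈p-y (σ⊆ x∈σ) (λ { refl → v∉ (σ⊆' x∈σ) })) ,
      (λ x∈ → proj₁ (x∈p-y⁻ _ x∈)) ,
      j' , j'<i , λ x∈ → let x∈φ , x≢v = x∈p-y⁻ _ x∈ in q x∈φ x≢v

    ridge-size : ∀ i {v} → v ∈ φ (lookup cs i) → ∣ φ (lookup cs i) - v ∣ ≡ d ∸ 1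
    ridge-size i v∈ = trans (∣p-x∣ v∈) (cong (_∸ 1) (∣φ∣ _))

    Inter-pure : ∀ i → 1 ≤ toℕ i → PureDim (d ∸ 1) (Inter i)
    Inter-pure i@(suc _) _ = (bound , top) , λ σ → λ { (e , maximal) → let v , v∈ , σ⊆ , e' = ridge i e in
        trans (cong ∣_∣ (sym (maximal _ e' σ⊆))) (ridge-size i v∈) }
      where
      bound : ∀ σ → Inter i σ → ∣ σ ∣ ≤ d ∸ 1
      bound σ e = let v , v∈ , σ⊆ , _ = ridge i e in subst (∣ σ ∣ ≤_) (ridge-size i v∈) (p⊆q⇒∣p∣≤∣q∣ σ⊆)
      top : ∃ λ σ → Inter i σ × ∣ σ ∣ ≡ d ∸ 1
      -- The empty face lies in the intersection since `i` is not the first index, and the ridge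
      -- around it has the required size.
      top = let v , v∈ , _ , e = ridge i {∅} (⊥⊆ , zero , s≤s z≤n , ⊥⊆) in _ , e , ridge-size i v∈

    PureDim-cong : ∀ {k} {C D : Subset n → Set} → (∀ σ → C σ → D σ) → (∀ σ → D σ → C σ) → PureDim k C → PureDim k D
    PureDim-cong f g ((b , σ , c , e) , p) =
      ((λ τ → b τ ∘ g τ) , σ , f σ c , e) , λ τ (c , m) → p τ (g τ c , λ υ → m υ ∘ f υ)

    ShellInter⇔Inter : ∀ i → let j , _ = map-index φ cs i in
      (∀ σ → Inter j σ → ShellInter (map φ cs) i σ) × (∀ σ → ShellInter (map φ cs) i σ → Inter j σ)
    ShellInter⇔Inter i with map-index φ cs i
    ... | j , e , l =
      (λ σ (p , k , k<j , q) → let k' , e' , l' = index-map φ cs k in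
          subst (σ ⊆_) (sym l) p , k' , subst₂ ℕ._<_ (sym e') e k<j , subst (σ ⊆_) (sym l') q) ,
      (λ σ (p , k , k<i , q) → let k' , e' , l' = map-index φ cs k in
          subst (σ ⊆_) l p , k' , subst₂ ℕ._<_ (sym e') (sym e) k<i , subst (σ ⊆_) l' q)

    shellable : Shellable d complex
    shellable = pure , map φ cs ,
      -- Equal facets would put the restriction of the later one inside the earlier one.
      AllPairs.map⁺ (AllPairs.map (λ {a} {b} n e → n (subst (ρ b ⊆_) (sym e) (ρ⊆φ b))) fresh) ,
      (λ σ σ∈ → let a , a∈ , e = ∈-map⁻ φ σ∈ in subst (IsFacet (IsFace complex)) (sym e) (facet a a∈)) ,
      facet⁻ ,
      λ i 1≤i → let j , e , _ = map-index φ cs i ; f , g = ShellInter⇔Inter i in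
        PureDim-cong f g (Inter-pure j (subst (1 ≤_) (sym e) 1≤i))

    -- A face in facet `i` either contains the restriction, and then lies in its interval, or misses
    -- one of its vertices and is passed by `step` to an earlier facet. The bound `k` on the index
    -- makes this descent terminate.
    cell : ∀ k i {σ} → toℕ i ℕ.< k → σ ⊆ φ (lookup cs i) → Any (λ a → Between (ρ a) (φ a) σ) cs
    cell (suc k) i {σ} (s≤s i≤k) σ⊆ with ρ (lookup cs i) ⊆? σ
    ... | yes ρ⊆ = Any.map (λ { refl → (λ {_} → ρ⊆) , (λ {_} → σ⊆) }) (∈-lookup {xs = cs} i)
    ... | no ρ⊈ with ⊈⇒∃ _ _ ρ⊈
    ...   | v , v∈ρ , v∉σ with step i v∈ρ
    ...     | j , j<i , q = cell k j (ℕ.<-≤-trans j<i i≤k) (λ x∈σ → q (σ⊆ x∈σ) λ { refl → v∉σ x∈σ })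

    cover : ∀ σ → IsFace complex σ ⇔ Any (λ a → Between (ρ a) (φ a) σ) cs
    cover σ = mk⇔ (λ e → let p = face⁻ e in cell _ (Any.index p) ℕ.≤-refl (Any.lookup-index p))
                  (λ p → face⁺ (Any.map (λ (_ , q) {x} → q {x}) p))

    disjoint : ∀ σ → AllPairs (λ a b → ¬ (Between (ρ a) (φ a) σ × Between (ρ b) (φ b) σ)) cs
    disjoint σ = AllPairs.map (λ n ((_ , p) , (q , _)) → n (λ x∈ → p (q x∈))) fresh

    hVec-complex : ∀ k → hVec d complex k ≡ Data.Integer.+ length (List.filter (λ a → ∣ ρ a ∣ ℕ.≟ k) cs)
    hVec-complex = hVec-partition complex ρ φ ρ⊆φ ∣φ∣ cs disjoint cover

-- The shelling attached to a compressed multicomplex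

module Realisation where

  open Compression
  open Words
  open Shellings
  open import Data.Nat
  open import Data.Nat.Properties
  open import Data.Nat.ListAction using () renaming (sum to ΣL)
  open import Data.Bool using (true; false; if_then_else_)
  import Data.Integer
  open import Data.Fin as Fin using (Fin; zero; suc; toℕ; _↑ʳ_)
  import Data.Fin.Properties as Fin
  open import Data.Fin.Subset using (Subset; _⊆_; ∣_∣)
  open import Data.Vec as Vec using (Vec; []; _∷_; lookup; _[_]≔_; sum; toList) renaming (_++_ to _++ᵛ_)
  open import Data.Vec.Properties using (lookup-++ʳ; []≔-++-↑ʳ; sum-++; length-toList; toList-injective; ++-injective; cast-is-id)
  open import Data.List as List using (List; []; _∷_; length; filter; map; _++_)
  open import Data.List.Membership.Propositional using (_∈_)
  open import Data.List.Membership.Propositional.Properties using (∈-map⁺; ∈-map⁻; ∈-lookup)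
  open import Data.List.Relation.Unary.Any as Any using (Any; here; there)
  import Data.List.Relation.Unary.Any.Properties as Any
  open import Data.List.Relation.Unary.All using ([]; _∷_)
  open import Data.List.Relation.Unary.AllPairs as AllPairs using (AllPairs; []; _∷_)
  import Data.List.Relation.Unary.AllPairs.Properties as AllPairs
  open import Data.List.Relation.Unary.Unique.Propositional using (Unique)
  open import Data.List.Relation.Unary.Sorted.TotalOrder.Properties using (Sorted⇒AllPairs)
  open import Data.List.Relation.Binary.Permutation.Propositional using (↭-sym; ↭⇒↭ₛ)
  open import Data.List.Relation.Binary.Permutation.Propositional.Properties using (filter-↭; ↭-length; ∈-resp-↭)
  open import Data.List.Relation.Binary.Lex.Core using (this; next; base)
  import Data.List.Relation.Binary.Lex.Strict as Lex
  open import Data.Product using (∃; ∃₂; _×_; _,_; proj₁; proj₂; ∃-syntax)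
  open import Data.Sum using (_⊎_; inj₁; inj₂)
  open import Function using (id; _∘_)
  open import Relation.Binary.Definitions using (tri<; tri≈; tri>)
  open import Relation.Binary.Bundles using (DecTotalOrder; StrictTotalOrder)
  open import Relation.Binary.Construct.Closure.Transitive using ([_]; _∷_)
  import Relation.Binary.Construct.On as On
  open import Relation.Binary.PropositionalEquality
  open import Relation.Nullary using (¬_; does; contradiction)
  open import Relation.Nullary.Decidable using (dec-true; dec-false)

  Step-det : ∀ {b c b' c' gs gs' gs''} → Step b c gs gs' → Step b' c' gs gs'' → b ≡ b' × gs' ≡ gs''
  Step-det skip skip = refl , refl
  Step-det tick tick = refl , refl
  Step-det mark mark = refl , refl

  -- The only possible ambiguity is between `letter` and `last` in mode `pend`, and `pend-bound`
  -- settles it. Hence the facet produced by an exchange is recognised from its exponents.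
  word-det : ∀ {σ ρ σ' ρ'} → Word μ r ps gs ys σ ρ → Word μ r ps gs ys σ' ρ' → σ ≡ σ'
  word-det (end _)        (end _)          = refl
  word-det (block _ w)    (block _ w')     = word-det w w'
  word-det (letter _ s w) (letter _ s' w') with refl , refl ← Step-det s s' = cong (_ ∷_) (word-det w w')
  word-det (letter _ _ w) (last _)         = contradiction (pend-bound w) (<-irrefl refl)
  word-det (last _)       (letter _ _ w')  = contradiction (pend-bound w') (<-irrefl refl)
  word-det (last w)       (last w')        = cong (_ ∷_) (word-det w w')
  word-det (after w)      (after w')       = cong (_ ∷_) (word-det w w')

  key : State → List ℕ
  key (gs , ys) = ys ++ gs

  ↓-≺ : ys ↓ ys' → ∀ {zs zs'} → (ys' ++ zs) ≺ (ys ++ zs')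
  ↓-≺ here      = this ≤-refl
  ↓-≺ (there q) = next refl (↓-≺ q)

  -- `lower` and `trade` lower an entry of `ys`, which stands before all gaps in the key; `drop` and
  -- `shift` lower the first gap that they change.
  Move-≺ : ∀ {s s'} → Move s s' → key s' ≺ key s
  Move-≺ {_ , ys} q with cases q
    where
    cases : ∀ {gs ys gs' ys'} → Move (gs , ys) (gs' , ys') →
            ys ↓ ys' ⊎ (ys ≡ ys' × gs' ≺ gs)
    cases drop      = inj₂ (refl , this ≤-refl)
    cases shift     = inj₂ (refl , this ≤-refl)
    cases (lower q) = inj₁ q
    cases (trade q) = inj₁ q
    cases (there q) with cases q
    ... | inj₁ q          = inj₁ q
    ... | inj₂ (refl , k) = inj₂ (refl , next refl k)
  ... | inj₁ q          = ↓-≺ q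
  ... | inj₂ (refl , k) = ++-≺ ys k

  lex-strict : StrictTotalOrder _ _ _
  lex-strict = Lex.<-strictTotalOrder <-strictTotalOrder

  lex : DecTotalOrder _ _ _
  lex = Lex.≤-decTotalOrder <-strictTotalOrder

  _≼_ : List ℕ → List ℕ → Set
  _≼_ = DecTotalOrder._≤_ lex

  Moves-≺ : ∀ {s s'} → Moves s s' → key s' ≺ key s
  Moves-≺ [ q ]    = Move-≺ q
  Moves-≺ (q ∷ qs) = StrictTotalOrder.trans lex-strict (Moves-≺ qs) (Move-≺ q)

  ≼⇒⊁ : ∀ {xs ys} → xs ≼ ys → ¬ ys ≺ xs
  ≼⇒⊁ (base _) (base ())
  ≼⇒⊁ (this l) (this k) = <-asym l k
  ≼⇒⊁ (this l) (next refl _) = <-irrefl refl l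
  ≼⇒⊁ (next refl _) (this k) = <-irrefl refl k
  ≼⇒⊁ (next _ l) (next _ k) = ≼⇒⊁ l k

  -- `i` gives exponent and `j` receives it. As in `key`, the bounded variables count as earlier
  -- than the unbounded ones.
  Precedes : ∀ {N} → ℕ → Fin N → Fin N → Set
  Precedes k i j = toℕ j < k × (toℕ i < toℕ j ⊎ k ≤ toℕ i)

  data Reduces {N} (k : ℕ) (u : Vec ℕ N) : Vec ℕ N → Set where
    decrement : ∀ c → 1 ≤ lookup u c → Reduces k u (u [ c ]≔ (lookup u c ∸ 1))
    transfers : ∀ {i j} → Precedes k i j → 1 ≤ lookup u i → Reduces k u (transfer i j u)

  ∷-Reduces : ∀ {N k x} {u u' : Vec ℕ N} → Reduces k u u' → Reduces (suc k) (x ∷ u) (x ∷ u')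
  ∷-Reduces (decrement c l) = decrement (suc c) l
  ∷-Reduces (transfers (l , inj₁ k) l') = transfers (s≤s l , inj₁ (s≤s k)) l'
  ∷-Reduces (transfers (l , inj₂ k) l') = transfers (s≤s l , inj₂ (s≤s k)) l'

  ↓-vec : ∀ {m} (b : Vec ℕ m) → toList b ↓ ys → ∃ λ c → 1 ≤ lookup b c × ys ≡ toList (b [ c ]≔ (lookup b c ∸ 1))
  ↓-vec (_ ∷ b) here      = zero , s≤s z≤n , refl
  ↓-vec (_ ∷ b) (there q) = let c , l , e = ↓-vec b q in suc c , l , cong (_ ∷_) e

  low-++ʳ : ∀ {k m} (a : Vec ℕ k) (b : Vec ℕ m) c →
            (a ++ᵛ b) [ k ↑ʳ c ]≔ (lookup (a ++ᵛ b) (k ↑ʳ c) ∸ 1) ≡ a ++ᵛ (b [ c ]≔ (lookup b c ∸ 1))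
  low-++ʳ {k} a b c = trans (cong (λ x → (a ++ᵛ b) [ k ↑ʳ c ]≔ (x ∸ 1)) (lookup-++ʳ a b c)) ([]≔-++-↑ʳ a b c)

  -- `drop` and `lower` are decrements. `shift` and `trade` are transfers into an unbounded
  -- variable, the second or the first of those reached through `there`.
  Move-vec : ∀ {k m} {s s'} → Move s s' → (a : Vec ℕ k) (b : Vec ℕ m) → s ≡ (toList a , toList b) →
             ∃₂ λ a' b' → s' ≡ (toList a' , toList b') × Reduces k (a ++ᵛ b) (a' ++ᵛ b')
  Move-vec drop (_ ∷ a) b refl = _ ∷ a , b , refl , decrement zero (s≤s z≤n)
  Move-vec shift (_ ∷ _ ∷ a) b refl = _ ∷ _ ∷ a , b , refl ,
    transfers {i = zero} {suc zero} (s≤s (s≤s z≤n) , inj₁ (s≤s z≤n)) (s≤s z≤n)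
  Move-vec (lower q) a b refl with ↓-vec b q
  ... | c , l , refl = a , _ , refl ,
    subst (Reduces _ _) (low-++ʳ a b c) (decrement (_ ↑ʳ c) (subst (1 ≤_) (sym (lookup-++ʳ a b c)) l))
  Move-vec (trade q) (g ∷ a) b refl with ↓-vec b q
  ... | c , l , refl = suc g ∷ a , _ , refl ,
    subst (Reduces _ _) (cong (suc g ∷_) (low-++ʳ a b c))
      (transfers {i = suc (_ ↑ʳ c)} {zero} (s≤s z≤n , inj₂ (s≤s (≤-trans (m≤m+n _ _) (≤-reflexive (sym (Fin.toℕ-↑ʳ _ c))))))
                 (subst (1 ≤_) (sym (lookup-++ʳ a b c)) l))
  Move-vec (there q) (x ∷ a) b refl with Move-vec q a b refl
  ... | a' , b' , refl , r = x ∷ a' , b' , refl , ∷-Reduces r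

  Moves-vec : ∀ {k m} (Q : Vec ℕ (k + m) → Set) → (∀ {u u'} → Q u → Reduces k u u' → Q u') →
              ∀ {s s'} → Moves s s' → (a : Vec ℕ k) (b : Vec ℕ m) → s ≡ (toList a , toList b) → Q (a ++ᵛ b) →
              ∃₂ λ a' b' → s' ≡ (toList a' , toList b') × Q (a' ++ᵛ b')
  Moves-vec Q c [ q ] a b e x =
    let a' , b' , e' , r = Move-vec q a b e in a' , b' , e' , c x r
  Moves-vec Q c (q ∷ qs) a b e x =
    let a' , b' , e' , r = Move-vec q a b e in Moves-vec Q c qs a' b' e' (c x r)

  toList-inj : ∀ {k} (a a' : Vec ℕ k) → toList a ≡ toList a' → a ≡ a'
  toList-inj a a' e = trans (sym (cast-is-id refl a)) (toList-injective refl a a' e)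

  sum-toList : ∀ {k} (a : Vec ℕ k) → ΣL (toList a) ≡ sum a
  sum-toList []      = refl
  sum-toList (x ∷ a) = cong (x +_) (sum-toList a)

  need-toList : ∀ {k} (a : Vec ℕ k) → need (toList a) ≡ sum a + k
  need-toList []      = refl
  need-toList {suc k} (x ∷ a) =
    trans (cong (suc x +_) (need-toList a)) (trans (sym (+-assoc (suc x) (sum a) k)) (sym (+-suc (x + sum a) k)))

  -- The first k coordinates are the unbounded variables. Exponents move to smaller weights.
  ω : ∀ {N} → ℕ → Fin N → ℕ
  ω k c = if does (toℕ c <? k) then k ∸ toℕ c else suc k

  Precedes⇒ω : ∀ {N k} {i j : Fin N} → Precedes k i j → ω k j < ω k i
  Precedes⇒ω {k = k} {i} {j} (j<k , inj₁ i<j)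
    rewrite dec-true (toℕ j <? k) j<k | dec-true (toℕ i <? k) (<-trans i<j j<k) = ∸-monoʳ-< i<j (<⇒≤ j<k)
  Precedes⇒ω {k = k} {i} {j} (j<k , inj₂ k≤i)
    rewrite dec-true (toℕ j <? k) j<k | dec-false (toℕ i <? k) (≤⇒≯ k≤i) = s≤s (m∸n≤m k (toℕ j))

  module Construction {m} (l : ℕ) (ps : Vec ℕ m) (d k : ℕ) (dkm : d + (k + m) ≡ l + sum ps) where

    record Cell : Set where
      constructor cell
      field
        xs : Vec ℕ k
        zs : Vec ℕ m
        {σ ρ} : Subset (l + sum ps)
        word  : Word free l ps (toList xs) (toList zs) σ ρ

      state : State
      state = toList xs , toList zs

      vec : Vec ℕ (k + m)
      vec = xs ++ᵛ zs
    open Cell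

    order : DecTotalOrder _ _ _
    order = On.decTotalOrder lex (key ∘ state)

    open import Data.List.Relation.Binary.Permutation.Setoid.Properties (setoid Cell) using (AllPairs-resp-↭)
    open import Data.List.Sort order using (sort; sort-↭; sort-↗)

    card : ∀ c → ∣ σ c ∣ ≡ d
    card c = +-cancelʳ-≡ (k + m) _ _ (trans (cong (∣ σ c ∣ +_)
      (sym (cong₂ _+_ (length-toList (xs c)) (length-toList (zs c))))) (trans (size (word c)) (sym dkm)))

    restriction-card : ∀ c → ∣ ρ c ∣ ≡ sum (vec c)
    restriction-card c = trans (restriction-size (word c))
      (trans (cong₂ _+_ (sum-toList (xs c)) (sum-toList (zs c))) (sym (sum-++ (xs c))))

    -- The bound on the degree provides the room: the entries of a monomial occupy its degree plus
    -- `k + m` vertices, and `d + (k + m)` vertices are available.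
    cells : (M : List (Vec ℕ (k + m))) →
            (∀ {u} → u ∈ M → sum u ≤ d × ∀ i → lookup u (k ↑ʳ i) < lookup ps i) →
            ∃ λ cs → map vec cs ≡ M
    cells []      ok = [] , refl
    cells (u ∷ M) ok with Vec.splitAt k u | cells M (ok ∘ there) | ok (here refl)
    ... | a , b , refl | cs , e | s≤d , fit =
      let _ , _ , w = word-free l (fits ps b λ i → subst (_< lookup ps i) (lookup-++ʳ a b i) (fit i)) room
      in cell a b w ∷ cs , cong (_ ∷_) e
      where
      fits : ∀ {m} (ps : Vec ℕ m) (b : Vec ℕ m) → (∀ i → lookup b i < lookup ps i) → Fits ps (toList b)
      fits []       []      f = []
      fits (p ∷ ps) (y ∷ b) f = f zero ∷ fits ps b (f ∘ suc)
      room : need (toList a) + need (toList b) ≤ l + sum ps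
      room = begin
        need (toList a) + need (toList b) ≡⟨ cong₂ _+_ (need-toList a) (need-toList b) ⟩
        sum a + k + (sum b + m)           ≡⟨ interchange (sum a) k (sum b) m ⟩
        sum a + sum b + (k + m)           ≡⟨ cong (_+ (k + m)) (sym (sum-++ a)) ⟩
        sum (a ++ᵛ b) + (k + m)           ≤⟨ +-monoˡ-≤ (k + m) s≤d ⟩
        d + (k + m)                       ≡⟨ dkm ⟩
        l + sum ps                        ∎
        where open ≤-Reasoning
              open import Algebra.Properties.CommutativeSemigroup +-commutativeSemigroup using (interchange)

    module _ (M : List (Vec ℕ (k + m)))
             (reduce : ∀ {u u'} → u ∈ M → Reduces k u u' → u' ∈ M)
             (cs : List Cell) (vecs : ∀ {u} → u ∈ M → u ∈ map vec cs) (vecs⁻ : ∀ {c} → c ∈ cs → vec c ∈ M)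
             (cs-unique : AllPairs (λ c c' → vec c ≢ vec c') cs)
             (sorted : AllPairs (λ c c' → key (state c) ≼ key (state c')) cs) where

      fresh : AllPairs (λ c c' → ¬ ρ c' ⊆ σ c) cs
      fresh = AllPairs.zipWith (λ {c} {c'} → new c c') (cs-unique , sorted)
        where
        new : ∀ c c' → vec c ≢ vec c' × key (state c) ≼ key (state c') → ¬ ρ c' ⊆ σ c
        new c c' (n , le) q with word-mono (word c') (word c)
                                    (trans (length-toList (xs c')) (sym (length-toList (xs c)))) q
        ... | inj₁ (e , e') = n (sym (cong₂ _++ᵛ_ (toList-inj (xs c') (xs c) e) (toList-inj (zs c') (zs c) e')))
        ... | inj₂ lt       = ≼⇒⊁ le lt

      -- The exchange stays inside `M` by `reduce`, so its exponents belong to a cell of the list,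
      -- whose facet is the exchanged one by `word-det`. Moves lower the key and the list is sorted,
      -- so this cell stands earlier.
      step : ∀ i {v} → v Data.Fin.Subset.∈ ρ (List.lookup cs i) →
             ∃ λ j → j Fin.< i × σ (List.lookup cs i) ⊆[ v ] σ (List.lookup cs j)
      step i v∈ with exchange free (word (List.lookup cs i)) v∈
      ... | _ , _ , _ , _ , _ , free , w , q , del
        with Moves-vec (_∈ M) reduce q (xs (List.lookup cs i)) (zs (List.lookup cs i)) refl (vecs⁻ (∈-lookup i))
      ... | a , b , refl , ab∈ with ∈-map⁻ vec (vecs ab∈)
      ... | c , c∈ , e = j , earlier , subst (σ (List.lookup cs i) ⊆[ _ ]_) same del
        where
        j = Any.index c∈
        c≡ : c ≡ List.lookup cs j
        c≡ = Any.lookup-index c∈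
        parts : a ≡ xs c × b ≡ zs c
        parts = ++-injective a (xs c) e
        same : _ ≡ σ (List.lookup cs j)
        same = trans (word-det w (subst₂ (λ a b → Word free l ps (toList a) (toList b) _ _)
                 (sym (proj₁ parts)) (sym (proj₂ parts)) (word c)))
               (cong σ c≡)
        state≡ : (toList a , toList b) ≡ state (List.lookup cs j)
        state≡ = trans (cong₂ (λ a b → toList a , toList b) (proj₁ parts) (proj₂ parts)) (cong state c≡)
        earlier : j Fin.< i
        lower-key : key (state (List.lookup cs j)) ≺ key (state (List.lookup cs i))
        lower-key = subst (λ s → key s ≺ key (state (List.lookup cs i))) state≡ (Moves-≺ q)
        earlier with Fin.<-cmp j i
        ... | tri< j<i _ _  = j<i
        ... | tri≈ _ refl _ = contradiction lower-key (≼⇒⊁ (DecTotalOrder.refl lex))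
        ... | tri> _ _ i<j  = contradiction lower-key (≼⇒⊁ (AllPairs-lookup sorted i<j))

    FVec-cells : ∀ cs i → length (filter (λ c → ∣ ρ c ∣ ≟ i) cs) ≡ FVec (map vec cs) i
    FVec-cells []       i = refl
    FVec-cells (c ∷ cs) i rewrite restriction-card c with does (sum (vec c) ≟ i)
    ... | true  = cong suc (FVec-cells cs i)
    ... | false = FVec-cells cs i

    shelling : (M : List (Vec ℕ (k + m))) → Unique M → M ≢ [] →
               (∀ {u u'} → u ∈ M → Reduces k u u' → u' ∈ M) →
               (∀ {u} → u ∈ M → sum u ≤ d × ∀ i → lookup u (k ↑ʳ i) < lookup ps i) →
               ∃[ Γ ] (SubcomplexOfΛ l ps Γ × Shellable d Γ × (∀ i → hVec d Γ i ≡ Data.Integer.+ FVec M i))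
    shelling M unique nonempty reduce ok with cells M ok
    ... | cs₀ , refl with sort cs₀ | sort-↭ cs₀ | sort-↗ cs₀
    -- Since `M` is nonempty, so is the sorted list; its head becomes the first facet.
    ... | []     | p | _ = contradiction (↭-length p) (empty≢ cs₀ nonempty)
      where
      empty≢ : ∀ cs → map vec cs ≢ [] → 0 ≢ length cs
      empty≢ []      n _ = n refl
    ... | c ∷ cs | p | sorted = complex , sub , shellable , λ i → trans (hVec-complex i)
            (cong Data.Integer.+_ (trans (↭-length (filter-↭ (λ c → ∣ ρ c ∣ ≟ i) p)) (FVec-cells cs₀ i)))
      where
      ascending : AllPairs (λ c c' → key (state c) ≼ key (state c')) (c ∷ cs)
      ascending = Sorted⇒AllPairs (DecTotalOrder.totalOrder order) sorted
      distinct : AllPairs (λ c c' → vec c ≢ vec c') (c ∷ cs)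
      distinct = AllPairs-resp-↭ (_∘ sym) ((λ { refl → id }) , (λ { refl → id })) (↭⇒↭ₛ (↭-sym p)) (AllPairs.map⁻ unique)
      here′ : ∀ {u} → u ∈ map vec cs₀ → u ∈ map vec (c ∷ cs)
      here′ u∈ with ∈-map⁻ vec u∈
      ... | c' , c'∈ , refl = ∈-map⁺ vec (∈-resp-↭ (↭-sym p) c'∈)
      there′ : ∀ {c'} → c' ∈ c ∷ cs → vec c' ∈ map vec cs₀
      there′ c'∈ = ∈-map⁺ vec (∈-resp-↭ p c'∈)
      open Shelling σ ρ (λ c → ρ⊆σ (word c)) card c cs
        (fresh (map vec cs₀) reduce (c ∷ cs) here′ there′ distinct ascending)
        (step (map vec cs₀) reduce (c ∷ cs) here′ there′ distinct ascending)
      sub : SubcomplexOfΛ l ps complex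
      sub τ e i P⊆τ with Any.satisfied (face⁻ e)
      ... | c , τ⊆σ = word-misses (word c) i (λ x∈ → τ⊆σ (P⊆τ x∈))

-- Choice of parameters and assembly

open import Data.Nat using (ℕ; zero; suc; _≤_; _<_; _∸_; _+_; z≤n; _<?_)
open import Data.Nat.Properties
open import Data.Integer using (+_)
open import Data.Fin using (zero; suc; toℕ; _↑ʳ_)
open import Data.Fin.Properties using (toℕ-↑ʳ)
open import Data.Vec using (Vec; []; _∷_; lookup; sum; _[_]≔_)
open import Data.List using (List)
open import Data.List.Membership.Propositional using (_∈_)
open import Data.Product using (_,_; proj₁; ∃-syntax; _×_)
open import Function using (_∘_)
open import Relation.Binary.PropositionalEquality using (_≡_; sym; trans; cong; subst; module ≡-Reasoning)
open Compression using (module Stabilise)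
open Realisation using (ω; Reduces; decrement; transfers; Precedes⇒ω; module Construction)

theorem1p2 : (l m : ℕ) (ps : Vec ℕ m) (d : ℕ) →
    1 ≤ l → (∀ i → 2 ≤ lookup ps i) → d ≤ (l + sum ps) ∸ m →
    (M : List (Vec ℕ (((l + sum ps) ∸ d ∸ m) + m))) →
    IsMulticomplex M → InS ((l + sum ps) ∸ d ∸ m) ps M → DegLe M d →
    ∃[ Γ ] (SubcomplexOfΛ l ps Γ × Shellable d Γ ×
    (∀ i → i ≤ d → hVec d Γ i ≡ + FVec M i))
theorem1p2 l m ps d 1≤l 2≤p d≤ M mc inS deg
  -- The targets are the unbounded variables, so no bounded exponent grows during compression.
  with Stabilise.stabilise (ω k) (λ c → toℕ c < k) (λ c → toℕ c <? k) M mc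
  where k = (l + sum ps) ∸ d ∸ m
... | M' , ((unique , nonempty , closed) , same , bounded) , stable =
  let Γ , sub , sh , h = shelling M' unique nonempty reduce ok
  in Γ , sub , sh , λ i _ → trans (h i) (cong +_ (same i))
  where
  k = (l + sum ps) ∸ d ∸ m
  m≤ : ∀ {m} (ps : Vec ℕ m) → (∀ i → 2 ≤ lookup ps i) → m ≤ sum ps
  m≤ []       f = z≤n
  m≤ (p ∷ ps) f = +-mono-≤ (<⇒≤ (f zero)) (m≤ ps (f ∘ suc))
  -- Neither subtraction in `k` is truncated, since `m ≤ sum ps` and `d ≤ (l + sum ps) ∸ m`.
  dkm : d + (k + m) ≡ l + sum ps
  dkm = begin
    d + (k + m)                          ≡⟨ sym (+-assoc d k m) ⟩
    d + k + m                            ≡⟨ cong (λ x → d + x + m) k≡ ⟩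
    d + (l + sum ps ∸ m ∸ d) + m         ≡⟨ cong (_+ m) (m+[n∸m]≡n d≤) ⟩
    l + sum ps ∸ m + m                   ≡⟨ m∸n+n≡m (≤-trans (m≤ ps 2≤p) (m≤n+m _ l)) ⟩
    l + sum ps                           ∎
    where
    open ≡-Reasoning
    k≡ : k ≡ l + sum ps ∸ m ∸ d
    k≡ = trans (∸-+-assoc (l + sum ps) d m) (trans (cong (l + sum ps ∸_) (+-comm d m)) (sym (∸-+-assoc (l + sum ps) m d)))
  open Construction l ps d k dkm
  reduce : ∀ {u u'} → u ∈ M' → Reduces k u u' → u' ∈ M'
  reduce {u} u∈ (decrement c l) = closed _ _ u∈ λ i → below u i c
    where
    below : ∀ {N} (u : Vec ℕ N) i c → lookup (u [ c ]≔ (lookup u c ∸ 1)) i ≤ lookup u i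
    below (x ∷ u) zero    zero    = m∸n≤m x 1
    below (x ∷ u) (suc i) zero    = ≤-refl
    below (x ∷ u) zero    (suc c) = ≤-refl
    below (x ∷ u) (suc i) (suc c) = below u i c
  reduce u∈ (transfers q l) = stable u∈ (proj₁ q) (Precedes⇒ω q) l
  ok : ∀ {u} → u ∈ M' → sum u ≤ d × ∀ i → lookup u (k ↑ʳ i) < lookup ps i
  ok {u} u∈ with bounded u∈
  ... | w , w∈ , s , b = subst (_≤ d) (sym s) (deg w w∈) , λ i → begin-strict
      -- Coordinates from `k` on are not targets, so `u` inherits the bounds of the original
      -- monomial `w`.
      lookup u (k ↑ʳ i)  ≤⟨ b (k ↑ʳ i) (λ lt → <⇒≱ lt (≤-trans (m≤m+n k _) (≤-reflexive (sym (toℕ-↑ʳ k i))))) ⟩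
      lookup w (k ↑ʳ i)  ≤⟨ inS w w∈ i ⟩
      lookup ps i ∸ 1    <⟨ ≤-reflexive (m+[n∸m]≡n (<⇒≤ (2≤p i))) ⟩
      lookup ps i        ∎
    where open ≤-Reasoning
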